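{- Let $n \geq 1$ and $w \geq 1$ be integers, and let $\mu = (\underbrace{w-1,\ldots,w-1}_{n},\underbrace{1,\ldots,1}_{n})$ be the vector consisting of $n$ entries equal to $w-1$ followed by $n$ entries equal to $1$. Then the Kostka number $K_{\lambda\mu}$, where $\lambda$ is the rectangular shape with $w$ columns and $n$ rows, equals $u_n(w)$, the number of permutations $\sigma \in S_n$ whose longest increasing subsequence has length at most $w$.
   Context: For a Young diagram $\lambda$ and a vector $\mu=(\mu_1,\mu_2,\ldots)$ of non-negative integers with $\sum_i \mu_i = |\lambda|$, the Kostka number $K_{\lambda\mu}$ is the number of semistandard Young tableaux of shape $\lambda$ (rows weakly increasing, columns strictly increasing) containing exactly $\mu_i$ copies of the number $i$ for each $i$. An increasing subsequence of $\sigma=(\sigma_1,\ldots,\sigma_n)\in S_n$ is $(\sigma_{i_1},\ldots,\sigma_{i_r})$ with $i_1<\cdots<i_r$ and $\sigma_{i_1}<\cdots<\sigma_{i_r}$. -}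

module Defs where

open import Data.Nat using (ℕ; zero; suc; _+_; _<ᵇ_; _≤ᵇ_; _≡ᵇ_; _⊔_)
open import Data.Bool using (Bool; true; false; _∧_; not)
open import Data.List using (List; []; _∷_; map; concatMap; filterᵇ; length; zipWith; upTo; foldr)
open import Data.Bool.ListAction using (and; all; any)
open import Data.Nat.ListAction using (sum)

oneTo : ℕ → List ℕ
oneTo m = map suc (upTo m)

allLists : ℕ → ℕ → List (List ℕ)
allLists m zero    = [] ∷ []
allLists m (suc k) = concatMap (λ x → map (x ∷_) (allLists m k)) (oneTo m)

-- A Young diagram λ is given by its list of row lengths (top to bottom).
-- A filling of shape λ with entries in {1,...,m}: a list of rows, the
-- i-th row having length λ_i.  (Rows left-aligned, English convention.)
fillings : ℕ → List ℕ → List (List (List ℕ))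
fillings m []      = [] ∷ []
fillings m (r ∷ λ') =
  concatMap (λ row → map (row ∷_) (fillings m λ')) (allLists m r)

weaklyIncreasing : List ℕ → Bool
weaklyIncreasing []           = true
weaklyIncreasing (x ∷ [])     = true
weaklyIncreasing (x ∷ y ∷ xs) = (x ≤ᵇ y) ∧ weaklyIncreasing (y ∷ xs)

columnsStrict : List (List ℕ) → Bool
columnsStrict []                 = true
columnsStrict (r ∷ [])           = true
columnsStrict (r ∷ r' ∷ rs) = and (zipWith _<ᵇ_ r r') ∧ columnsStrict (r' ∷ rs)

isSSYT : List (List ℕ) → Bool
isSSYT T = all weaklyIncreasing T ∧ columnsStrict T

countIn : ℕ → List (List ℕ) → ℕ
countIn i T = sum (map (λ row → length (filterᵇ (λ x → x ≡ᵇ i) row)) T)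

hasContentFrom : ℕ → List ℕ → List (List ℕ) → Bool
hasContentFrom i []       T = true
hasContentFrom i (c ∷ μ) T = (countIn i T ≡ᵇ c) ∧ hasContentFrom (suc i) μ T

hasContent : List ℕ → List (List ℕ) → Bool
hasContent μ T = hasContentFrom 1 μ T

-- Kostka number K_{λμ}: number of SSYT of shape λ with content μ.
-- (Entries are drawn from {1,...,length μ}; any entry larger than that
-- would have multiplicity 0 = μ_i anyway.)
Kostka : List ℕ → List ℕ → ℕ
Kostka λ' μ = length (filterᵇ (λ T → isSSYT T ∧ hasContent μ T)
                             (fillings (length μ) λ'))

distinct : List ℕ → Bool
distinct []       = true
distinct (x ∷ xs) = not (any (λ y → x ≡ᵇ y) xs) ∧ distinct xs

-- S_n as one-line notations (σ_1,...,σ_n): lists of length n with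
-- entries in {1..n}, all distinct.
permutations : ℕ → List (List ℕ)
permutations n = filterᵇ distinct (allLists n n)

subsequences : List ℕ → List (List ℕ)
subsequences []       = [] ∷ []
subsequences (x ∷ xs) = subsequences xs Data.List.++ map (x ∷_) (subsequences xs)

strictlyIncreasing : List ℕ → Bool
strictlyIncreasing []           = true
strictlyIncreasing (x ∷ [])     = true
strictlyIncreasing (x ∷ y ∷ xs) = (x <ᵇ y) ∧ strictlyIncreasing (y ∷ xs)

lis : List ℕ → ℕ
lis σ = foldr _⊔_ 0 (map length (filterᵇ strictlyIncreasing (subsequences σ)))

u : ℕ → ℕ → ℕ
u n w = length (filterᵇ (λ σ → lis σ ≤ᵇ w) (permutations n))

{-# OPTIONS --safe #-}
module Submission where

-- Each i ≤ n is missing from exactly one column of the tableau, and each i > n occurs in exactly one column. Recording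
-- these columns, numbered from the right, for i = 1, …, n and for i = 2n, …, n + 1 gives two words: the
-- rows of the tableau increase weakly iff both words are lattice words, and the columns have length n iff the words have
-- the same content. So the tableaux are the pairs of standard tableaux of the same shape with n cells and at most
-- w columns. Robinson–Schensted matches these pairs with the permutations in S_n, and the first row of the shape obeys
-- the recursion for the longest increasing subsequence.

open import Defs
open import Algebra.Properties.CommutativeSemigroup using (interchange; x∙yz≈y∙xz)
open import Data.Bool using (Bool; true; false; T; T?; if_then_else_; _∧_)
open import Data.Bool.ListAction using (and; any)
open import Data.Bool.Properties using (T-∧)
open import Data.Empty using (⊥; ⊥-elim)
open import Data.List using (List; []; _∷_; _++_; length; drop; replicate; map; foldr; filterᵇ; applyUpTo;
  applyDownFrom; concatMap; cartesianProductWith; zipWith)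
open import Data.List.Membership.Propositional using (_∈_; _∉_)
open import Data.List.Membership.Propositional.Properties using (∈-∃++; ∈-++⁻; ∈-++⁺ˡ; ∈-++⁺ʳ;
  ∈-cartesianProductWith⁺; ∈-cartesianProductWith⁻; ∈-map⁺; ∈-map⁻; ∈-upTo⁺; ∈-upTo⁻; ∈-filter⁺; ∈-filter⁻)
open import Data.List.Properties
open import Data.List.Relation.Unary.All using (All; []; _∷_)
import Data.List.Relation.Unary.All as All
import Data.List.Relation.Unary.All.Properties as All
open import Data.List.Relation.Unary.AllPairs using (AllPairs; []; _∷_)
open import Data.List.Relation.Unary.Any using (here; there)
import Data.List.Relation.Unary.Any as Any
open import Data.List.Relation.Unary.Any.Properties using (any⁺; any⁻)
open import Data.List.Relation.Unary.Linked using (Linked; []; [-]; _∷_)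
import Data.List.Relation.Unary.Linked as Linked
import Data.List.Relation.Unary.Linked.Properties as Linked
open import Data.List.Relation.Unary.Unique.Propositional using (Unique)
import Data.List.Relation.Unary.Unique.Propositional.Properties as Unique
open import Data.Nat
open import Data.Nat.Properties
open import Data.Product using (_×_; _,_; proj₁; proj₂; ∃; ∃₂)
open import Data.Sum using (_⊎_; inj₁; inj₂)
open import Data.Unit using (⊤; tt)
open import Function using (_∘_; _⇔_; mk⇔; Equivalence)
open import Function.Properties.Equivalence using (⇔-isEquivalence)
open import Level using (0ℓ)
open import Relation.Binary using (IsEquivalence; tri<; tri≈; tri>)
open import Relation.Binary.PropositionalEquality
open import Relation.Nullary using (¬_; yes; no; contradiction)

open IsEquivalence (⇔-isEquivalence {0ℓ}) using () renaming (sym to ⇔-sym; trans to ⇔-trans)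

-- The recorded letters are at most `w`, so the shape of the two words has at most `w` rows, whereas
-- the longest increasing subsequence is read from the first row. Both words are therefore
-- transposed before the Robinson-Schensted step; without this, decreasing subsequences would
-- appear. The values above `n` are read downwards because all columns end with `n` cells: comparing
-- the numbers of entries at most `v` in adjacent columns compares missing values when `v ≤ n`, and
-- values still to come when `v ≥ n`. A word of row numbers stands for a standard tableau, each
-- position telling the row of one value. A partial insertion tableau is then a word with blanks,
-- insertion changes letters without moving them, and comparing shapes is comparing multiplicities.
-- No inverse functions are built for the count: one relation between tableaux and permutations,
-- total and injective in both directions, gives two inequalities between lengths.

𝟙 : Bool → ℕ
𝟙 b = if b then 1 else 0

δ : ℕ → ℕ → ℕ
δ x v = 𝟙 (x ≡ᵇ v)

count : ℕ → List ℕ → ℕ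
count v []       = 0
count v (x ∷ xs) = δ x v + count v xs

δ-refl : ∀ x → δ x x ≡ 1
δ-refl zero    = refl
δ-refl (suc x) = δ-refl x

δ-≢ : ∀ {x v} → x ≢ v → δ x v ≡ 0
δ-≢ {zero}  {zero}  ne = contradiction refl ne
δ-≢ {zero}  {suc v} ne = refl
δ-≢ {suc x} {zero}  ne = refl
δ-≢ {suc x} {suc v} ne = δ-≢ (ne ∘ cong suc)

δ≡1⇒≡ : ∀ {x v} → δ x v ≡ 1 → x ≡ v
δ≡1⇒≡ {x} {v} e with x ≟ v
... | yes p = p
... | no ne with () ← trans (sym e) (δ-≢ ne)

-- Lattice words and insertion

-- Read from its end to its head, a word builds a Young diagram: the letter l ≥ 1 adds a cell to row l, and the
-- letter 0 is a blank that adds nothing.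
Part : List ℕ → Set
Part W = ∀ t → count (2 + t) W ≤ count (1 + t) W

Lattice : List ℕ → Set
Lattice []      = ⊤
Lattice (s ∷ W) = Part (s ∷ W) × Lattice W

Lattice⇒Part : ∀ {W} → Lattice W → Part W
Lattice⇒Part {[]}    _       t = z≤n
Lattice⇒Part {s ∷ W} (p , _)   = p

-- Schensted insertion on words: a 1 is put at the blank position k of W, the nearest 1 on its left becomes a 2, the
-- nearest 2 on the left of that becomes a 3, and so on; the resulting word V has one more cell in row r. This is
-- Fomin's local rule along one row of a growth diagram.
data Ins : List ℕ → ℕ → ℕ → List ℕ → Set where
  mark : ∀ {W} → Ins (0 ∷ W) 0 1 (1 ∷ W)
  bump : ∀ {W k r V} → Ins W k r V → Ins (r ∷ W) (suc k) (suc r) (suc r ∷ V)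
  pass : ∀ {W k r V s} → s ≢ r → Ins W k r V → Ins (s ∷ W) (suc k) r (s ∷ V)

Ins-pos : ∀ {W k r V} → Ins W k r V → 0 < r
Ins-pos mark       = z<s
Ins-pos (bump i)   = z<s
Ins-pos (pass _ i) = Ins-pos i

Ins-length : ∀ {W k r V} → Ins W k r V → length V ≡ length W
Ins-length mark       = refl
Ins-length (bump i)   = cong suc (Ins-length i)
Ins-length (pass _ i) = cong suc (Ins-length i)

Ins-index : ∀ {W k r V} → Ins W k r V → k < length W
Ins-index mark       = z<s
Ins-index (bump i)   = s<s (Ins-index i)
Ins-index (pass _ i) = s<s (Ins-index i)

Ins-count : ∀ {W k r V} → Ins W k r V → ∀ t → count (suc t) V ≡ δ r (suc t) + count (suc t) W
Ins-count mark t = refl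
Ins-count {r = suc r} (bump i) t = cong (δ r t +_) (Ins-count i t)
Ins-count {W = s ∷ W} {r = r} (pass _ i) t =
  trans (cong (δ s (suc t) +_) (Ins-count i t)) (x∙yz≈y∙xz +-commutativeSemigroup (δ s (suc t)) (δ r (suc t)) _)

Ins-count0 : ∀ {W k r V} → Ins W k r V → count 0 W ≡ suc (count 0 V)
Ins-count0 mark = refl
Ins-count0 (bump {r = zero} i) = contradiction (Ins-pos i) λ ()
Ins-count0 (bump {r = suc r} i) = Ins-count0 i
Ins-count0 {W = s ∷ W} (pass _ i) = trans (cong (δ s 0 +_) (Ins-count0 i)) (+-suc (δ s 0) _)

Ins-functional : ∀ {W k r r' V V'} → Ins W k r V → Ins W k r' V' → r ≡ r' × V ≡ V'
Ins-functional mark mark = refl , refl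
Ins-functional (bump i) (bump j) with refl , refl ← Ins-functional i j = refl , refl
Ins-functional (bump i) (pass ne j) with refl , refl ← Ins-functional i j = contradiction refl ne
Ins-functional (pass ne i) (bump j) with refl , refl ← Ins-functional i j = contradiction refl ne
Ins-functional (pass _ i) (pass _ j) with refl , refl ← Ins-functional i j = refl , refl

-- The head of `V` reveals the last constructor: it equals the final row after `mark` and `bump`,
-- and differs from it after `pass`. A final row 1 singles out `mark`, since the row that `bump`
-- raises is already positive.
Ins-injective : ∀ {W W' k k' r V} → Ins W k r V → Ins W' k' r V → W ≡ W' × k ≡ k'
Ins-injective mark mark = refl , refl
Ins-injective mark (bump j) = contradiction (Ins-pos j) λ ()
Ins-injective mark (pass ne j) = contradiction refl ne
Ins-injective (bump i) mark = contradiction (Ins-pos i) λ ()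
Ins-injective (bump i) (bump j) with refl , refl ← Ins-injective i j = refl , refl
Ins-injective (bump i) (pass ne j) = contradiction refl ne
Ins-injective (pass ne i) mark = contradiction refl ne
Ins-injective (pass ne i) (bump j) = contradiction refl ne
Ins-injective (pass _ i) (pass _ j) with refl , refl ← Ins-injective i j = refl , refl

Blank : List ℕ → ℕ → Set
Blank []      k       = ⊥
Blank (s ∷ W) zero    = s ≡ 0
Blank (s ∷ W) (suc k) = Blank W k

insert : ∀ {W k} → Blank W k → ∃₂ λ r V → Ins W k r V
insert {s ∷ W} {zero} refl = _ , _ , mark
insert {s ∷ W} {suc k} b with insert {W} {k} b
... | r , V , i with s ≟ r
... | yes refl = _ , _ , bump i
... | no ne    = _ , _ , pass ne i

Ins-blank : ∀ {W k r V} → Ins W k r V → Blank W k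
Ins-blank mark       = refl
Ins-blank (bump i)   = Ins-blank i
Ins-blank (pass _ i) = Ins-blank i

Ins-blank-fill : ∀ {W k r V} → Ins W k r V → ¬ Blank V k
Ins-blank-fill mark       ()
Ins-blank-fill (bump i)   = Ins-blank-fill i
Ins-blank-fill (pass _ i) = Ins-blank-fill i

Ins-blank⁺ : ∀ {W k r V j} → Ins W k r V → j ≢ k → Blank W j → Blank V j
Ins-blank⁺ {j = zero}  mark       ne b = contradiction refl ne
Ins-blank⁺ {j = suc j} mark       ne b = b
Ins-blank⁺ {j = zero}  (bump i)   ne refl = contradiction (Ins-pos i) λ ()
Ins-blank⁺ {j = suc j} (bump i)   ne b = Ins-blank⁺ i (ne ∘ cong suc) b
Ins-blank⁺ {j = zero}  (pass _ i) ne b = b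
Ins-blank⁺ {j = suc j} (pass _ i) ne b = Ins-blank⁺ i (ne ∘ cong suc) b

Ins-blank⁻ : ∀ {W k r V j} → Ins W k r V → Blank V j → Blank W j
Ins-blank⁻ {j = suc j} mark       b = b
Ins-blank⁻ {j = suc j} (bump i)   b = Ins-blank⁻ i b
Ins-blank⁻ {j = zero}  (pass _ i) b = b
Ins-blank⁻ {j = suc j} (pass _ i) b = Ins-blank⁻ i b

-- In shape, `s ∷ V` is the union of `s ∷ W` and `V`, two partitions that extend `W` in different
-- rows, and a union of partitions is a partition.
Ins-part : ∀ {W k r V s} → s ≢ r → Ins W k r V → Part (s ∷ W) → Part V → Part (s ∷ V)
Ins-part {W} {k} {r} {V} {s} ne i psW pV t with s ≟ 2 + t
... | no s≢ rewrite δ-≢ s≢ = ≤-trans (pV t) (m≤n+m _ (δ s (suc t)))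
... | yes refl rewrite Ins-count i (suc t) | Ins-count i t | δ-≢ (ne ∘ sym) =
  ≤-trans (psW t) (+-monoʳ-≤ (δ s (suc t)) (m≤n+m _ (δ r (suc t))))

-- Here both extensions of `W` add the same cell, at the end of row `r`, so a further cell goes to
-- row `suc r`. It fits: in `W` that row was no longer than row `r`, and row `r` has grown as well.
Ins-part-bump : ∀ {W k r V} → Ins W k r V → Part W → Part (r ∷ W) → Part (suc r ∷ V)
Ins-part-bump {W} {k} {r} {V} i pW prW t rewrite Ins-count i (suc t) | Ins-count i t with r ≟ suc t
... | no r≢ rewrite δ-≢ r≢ = ≤-trans (prW t) (≤-trans (≤-reflexive (cong (_+ count (1 + t) W) (δ-≢ r≢))) (m≤n+m _ (δ r t)))
... | yes refl rewrite δ-refl t | δ-≢ {t} {suc t} (1+n≢n ∘ sym) = ≤-trans (s≤s (pW t)) (m≤n+m _ _)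

Ins-lattice : ∀ {W k r V} → Ins W k r V → Lattice W → Lattice V
Ins-lattice {0 ∷ W} mark (p , l) = part , l
  where
  part : Part (1 ∷ W)
  part zero    = m≤n⇒m≤1+n (p zero)
  part (suc t) = p (suc t)
Ins-lattice (bump i) (p , l) = Ins-part-bump i (Lattice⇒Part l) p , Ins-lattice i l
Ins-lattice (pass ne i) (p , l) = let l' = Ins-lattice i l in Ins-part ne i p (Lattice⇒Part l') , l'

unpart : ∀ {W k r V} → Ins W k (suc r) V → Part V → count (2 + r) V < count (1 + r) V → Part W
unpart {W} {k} {r} {V} i pV rem t with r ≟ t
... | yes refl = s≤s⁻¹ (≤-trans (s≤s lem) rem')
  where
  lem : count (2 + r) W ≤ count (2 + r) V
  lem rewrite Ins-count i (suc t) = m≤n+m _ (δ r (suc t))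
  rem' : count (2 + r) V < suc (count (1 + r) W)
  rem' = subst (count (2 + r) V <_) (trans (Ins-count i r) (cong (_+ count (1 + r) W) (δ-refl r))) rem
... | no ne = ≤-trans (m≤n+m _ (δ r (suc t))) (≤-trans (≤-reflexive (sym (Ins-count i (suc t))))
  (≤-trans (pV t) (≤-reflexive (trans (Ins-count i t) (cong (_+ count (1 + t) W) (δ-≢ ne))))))

-- The hypothesis says that row r + 1 of the shape of V ends in a corner.
uninsert : ∀ V r → Lattice V → count (2 + r) V < count (1 + r) V → ∃₂ λ W k → Lattice W × Ins W k (suc r) V
uninsert (s ∷ V) r (p , l) rem with s ≟ suc r
uninsert (s ∷ V) zero (p , l) rem | yes refl = 0 ∷ V , 0 , (Lattice⇒Part l , l) , mark
uninsert (s ∷ V) (suc r) (p , l) rem | yes refl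
  -- The head was raised from `suc r`, so the removal continues in row `suc r` of `V`. That row ends
  -- in a corner: `s ∷ V` is a partition with one cell more than `V` in row `2 + r`, hence row
  -- `2 + r` of `V` is strictly shorter.
  with W , k , lW , i ← uninsert V r l
    (subst₂ _≤_ (cong (_+ count (2 + r) V) (δ-refl r)) (cong (_+ count (1 + r) V) (δ-≢ {suc r} {r} 1+n≢n)) (p r))
  = suc r ∷ W , suc k , (unbump , lW) , bump i
  where
  unbump : Part (suc r ∷ W)
  unbump t = subst₂ _≤_ (Ins-count i (suc t)) (Ins-count i t) (Lattice⇒Part l t)
... | no ne with W , k , lW , i ← uninsert V r l
    (≤-trans (s≤s (m≤n+m _ (δ s (2 + r)))) (≤-trans rem (≤-reflexive (cong (_+ count (1 + r) V) (δ-≢ ne)))))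
  = s ∷ W , suc k , (unpart (pass ne i) p rem , lW) , pass ne i

-- Conjugate shapes

-- Replaces the row of each added cell by its column.
transpose : List ℕ → List ℕ
transpose []      = []
transpose (s ∷ W) = suc (count s W) ∷ transpose W

transpose-length : ∀ W → length (transpose W) ≡ length W
transpose-length []      = refl
transpose-length (s ∷ W) = cong suc (transpose-length W)

transpose-pos : ∀ W → All (0 <_) (transpose W)
transpose-pos []      = []
transpose-pos (s ∷ W) = z<s ∷ transpose-pos W

Part-antitone : ∀ {W} → Part W → ∀ {a b} → a ≤ b → count (suc b) W ≤ count (suc a) W
Part-antitone {W} p {a} a≤b = go (≤⇒≤′ a≤b)
  where
  go : ∀ {b} → a ≤′ b → count (suc b) W ≤ count (suc a) W
  go ≤′-refl       = ≤-refl
  go (≤′-step a≤b) = ≤-trans (p _) (go a≤b)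

-- A cell can be added to row `suc a` only if every row above it is strictly longer; the rows below
-- are never longer.
corner : ∀ {a W} → Part (suc a ∷ W) → Part W → ∀ r → count (suc a) W < count (suc r) W ⇔ r < a
corner {a} {W} p pW r = mk⇔ to from
  where
  to : count (suc a) W < count (suc r) W → r < a
  to lt with r <? a
  ... | yes q = q
  ... | no nq = contradiction (≤-trans lt (Part-antitone {W} pW (≮⇒≥ nq))) (<-irrefl refl)
  from : r < a → count (suc a) W < count (suc r) W
  from r<a = subst₂ _≤_ (cong (_+ count (suc a) W) (δ-refl a))
    (cong (_+ count (suc r) W) (δ-≢ {suc a} {suc r} (<⇒≢ r<a ∘ sym ∘ suc-injective)))
    (Part-antitone {suc a ∷ W} p (<⇒≤ r<a))

<-≡ : ∀ {m n} → (∀ r → r < m ⇔ r < n) → m ≡ n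
<-≡ {m} {n} h with <-cmp m n
... | tri< lt _ _ = contradiction (Equivalence.from (h m) lt) (<-irrefl refl)
... | tri≈ _ e _ = e
... | tri> _ _ gt = contradiction (Equivalence.to (h n) gt) (<-irrefl refl)

<-suc-≢ : ∀ {m n} → m ≢ n → m < suc n ⇔ m < n
<-suc-≢ ne = mk⇔ (λ lt → ≤∧≢⇒< (s≤s⁻¹ lt) ne) m<n⇒m<1+n

-- Here `s` and `t` are the row and the column of a cell, numbered from 0. The induction is joint
-- with `transpose-column`: reflecting the newest cell requires that it lie at the foot of its
-- column, and the length of that column is read from the cells of the older shape. A blank would
-- turn into a cell, hence the positivity.
transpose-cells : ∀ {W} → Lattice W → All (0 <_) W → ∀ s t →
  t < count (suc s) W ⇔ s < count (suc t) (transpose W)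

transpose-column : ∀ {a W} → Part (suc a ∷ W) → Lattice W → All (0 <_) W →
  count (suc (count (suc a) W)) (transpose W) ≡ a
transpose-column {a} {W} p l h = <-≡ λ r →
  ⇔-trans (⇔-sym (transpose-cells l h r (count (suc a) W))) (corner {a} {W} p (Lattice⇒Part l) r)

transpose-cells {[]} _ _ s t = mk⇔ (λ ()) (λ ())
transpose-cells {suc a ∷ W} (p , l) (_ ∷ h) s t with a ≟ s | count (suc a) W ≟ t
... | yes refl | yes refl rewrite δ-refl a | δ-refl (count (suc a) W) | transpose-column {a} {W} p l h =
  mk⇔ (λ _ → ≤-refl) (λ _ → ≤-refl)
... | yes refl | no ne rewrite δ-refl a | δ-≢ ne =
  ⇔-trans (<-suc-≢ (ne ∘ sym)) (transpose-cells l h a t)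
... | no ne | yes refl rewrite δ-≢ ne | δ-refl (count (suc a) W) | transpose-column {a} {W} p l h =
  ⇔-trans (corner {a} {W} p (Lattice⇒Part l) s) (⇔-sym (<-suc-≢ (ne ∘ sym)))
... | no ne | no ne' rewrite δ-≢ ne | δ-≢ ne' = transpose-cells l h s t

transpose-involutive : ∀ {W} → Lattice W → All (0 <_) W → transpose (transpose W) ≡ W
transpose-involutive {[]} _ _ = refl
transpose-involutive {suc a ∷ W} (p , l) (_ ∷ h) =
  cong₂ _∷_ (cong suc (transpose-column p l h)) (transpose-involutive l h)

-- Otherwise `W` would have a cell in column `suc t` whose left neighbour in column `t` is missing.
transpose-part : ∀ {W} → Lattice W → All (0 <_) W → Part (transpose W)
transpose-part {W} l h t = ≮⇒≥ λ lt → <-irrefl refl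
  (Equivalence.to (transpose-cells l h (count (suc t) (transpose W)) t)
    (<-trans (n<1+n t) (Equivalence.from (transpose-cells l h _ (suc t)) lt)))

transpose-lattice : ∀ {W} → Lattice W → All (0 <_) W → Lattice (transpose W)
transpose-lattice {[]} l h = tt
transpose-lattice {s ∷ W} l h = transpose-part l h , transpose-lattice (proj₂ l) (All.tail h)

transpose-shape : ∀ {V W} → Lattice V → Lattice W → All (0 <_) V → All (0 <_) W →
  (∀ t → count (suc t) V ≡ count (suc t) W) → ∀ t → count (suc t) (transpose V) ≡ count (suc t) (transpose W)
transpose-shape lV lW hV hW e t = <-≡ λ r → ⇔-trans (⇔-sym (transpose-cells lV hV r t))
  (⇔-trans (mk⇔ (subst (t <_) (e r)) (subst (t <_) (sym (e r)))) (transpose-cells lW hW r t))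

-- Longest increasing subsequences

-- The greatest length of an increasing subsequence with all entries above `v`. The threshold is
-- what closes the recursion on the head.
best : ℕ → List ℕ → ℕ
best v []       = 0
best v (x ∷ xs) = if v <ᵇ x then best v xs ⊔ suc (best x xs) else best v xs

maximum : List ℕ → ℕ
maximum = foldr _⊔_ 0

maximum-++ : ∀ xs ys → maximum (xs ++ ys) ≡ maximum xs ⊔ maximum ys
maximum-++ []       ys = refl
maximum-++ (x ∷ xs) ys = trans (cong (x ⊔_) (maximum-++ xs ys)) (sym (⊔-assoc x _ _))

maximum-suc : ∀ x xs → maximum (map suc (x ∷ xs)) ≡ suc (maximum (x ∷ xs))
maximum-suc x []       = cong suc (sym (⊔-identityʳ x))
maximum-suc x (y ∷ ys) = cong (suc x ⊔_) (maximum-suc y ys)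

maxLength : (List ℕ → Bool) → List (List ℕ) → ℕ
maxLength p L = maximum (map length (filterᵇ p L))

maxLength-++ : ∀ p xs ys → maxLength p (xs ++ ys) ≡ maxLength p xs ⊔ maxLength p ys
maxLength-++ p xs ys = trans (cong (maximum ∘ map length) (filter-++ (T? ∘ p) xs ys))
  (trans (cong maximum (map-++ length (filterᵇ p xs) (filterᵇ p ys))) (maximum-++ (map length (filterᵇ p xs)) _))

maxLength-map-false : ∀ {p x} → (∀ l → p (x ∷ l) ≡ false) → ∀ L → maxLength p (map (x ∷_) L) ≡ 0
maxLength-map-false h []      = refl
maxLength-map-false h (l ∷ L) rewrite h l = maxLength-map-false h L

lengths-map-true : ∀ {p q : List ℕ → Bool} {x} → (∀ l → p (x ∷ l) ≡ q l) → ∀ L →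
  map length (filterᵇ p (map (x ∷_) L)) ≡ map suc (map length (filterᵇ q L))
lengths-map-true h []      = refl
lengths-map-true {q = q} h (l ∷ L) rewrite h l with q l
... | true  = cong (suc (length l) ∷_) (lengths-map-true h L)
... | false = lengths-map-true h L

subsequences-[] : ∀ xs → ∃ λ L → subsequences xs ≡ [] ∷ L
subsequences-[] []       = _ , refl
subsequences-[] (x ∷ xs) with L , e ← subsequences-[] xs rewrite e = _ , refl

maxLength-map-true : ∀ {p q : List ℕ → Bool} {x} → (∀ l → p (x ∷ l) ≡ q l) → q [] ≡ true → ∀ xs →
  maxLength p (map (x ∷_) (subsequences xs)) ≡ suc (maxLength q (subsequences xs))
maxLength-map-true {p} {q} h q[] xs with L , e ← subsequences-[] xs rewrite e | h [] | q[] =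
  trans (cong (λ ls → maximum (1 ∷ ls)) (lengths-map-true {q = q} h L)) (maximum-suc 0 (map length (filterᵇ q L)))

maxLength-best : ∀ v xs → maxLength (λ l → strictlyIncreasing (v ∷ l)) (subsequences xs) ≡ best v xs
maxLength-best v []       = refl
maxLength-best v (x ∷ xs) with v <ᵇ x in e
... | true  = trans (maxLength-++ _ (subsequences xs) _) (cong₂ _⊔_ (maxLength-best v xs)
  (trans (maxLength-map-true {q = λ l → strictlyIncreasing (x ∷ l)} (λ l → cong (_∧ strictlyIncreasing (x ∷ l)) e) refl xs)
    (cong suc (maxLength-best x xs))))
... | false = trans (maxLength-++ _ (subsequences xs) _) (trans (cong₂ _⊔_ (maxLength-best v xs)
  (maxLength-map-false (λ l → cong (_∧ strictlyIncreasing (x ∷ l)) e) (subsequences xs))) (⊔-identityʳ _))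

-- For positive entries the threshold 0 excludes nothing.
lis≡best : ∀ {xs} → All (0 <_) xs → lis xs ≡ best 0 xs
lis≡best [] = refl
lis≡best {suc x ∷ xs} (_ ∷ h) = trans (maxLength-++ strictlyIncreasing (subsequences xs) _) (cong₂ _⊔_ (lis≡best h)
  (trans (maxLength-map-true {q = λ l → strictlyIncreasing (suc x ∷ l)} (λ _ → refl) refl xs)
    (cong suc (maxLength-best (suc x) xs))))

-- Position `k` stands for the value `k + 1`, so these are the first-row entries of the insertion
-- tableau that exceed `v`.
onesFrom : ℕ → List ℕ → ℕ
onesFrom v W = count 1 (drop v W)

-- If no 1 stands to the left of position `k`, the new 1 displaces nothing and the final row is 1.
-- Otherwise it displaces a 1, and `W` has more ones than its part behind `k`.
Ins-onesFrom-carry : ∀ {W k r V} → Ins W k r V →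
  (r ≡ 1 × count 1 W ≡ onesFrom (suc k) W) ⊎ (r ≢ 1 × onesFrom (suc k) W < count 1 W)
Ins-onesFrom-carry mark = inj₁ (refl , refl)
Ins-onesFrom-carry (bump i) with Ins-onesFrom-carry i
... | inj₁ (refl , e) = inj₂ ((λ ()) , s≤s (≤-reflexive (sym e)))
... | inj₂ (ne , lt) = inj₂ ((λ e → contradiction (subst (0 <_) (suc-injective e) (Ins-pos i)) λ ()) , ≤-trans lt (m≤n+m _ _))
Ins-onesFrom-carry {s ∷ W} (pass ne i) with Ins-onesFrom-carry i
... | inj₁ (refl , e) = inj₁ (refl , trans (cong (_+ count 1 W) (δ-≢ ne)) e)
... | inj₂ (ne' , lt) = inj₂ (ne' , ≤-trans lt (m≤n+m _ (δ s 1)))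

Ins-onesFrom-0 : ∀ {W k r V} → Ins W k r V → count 1 V ≡ count 1 W ⊔ suc (onesFrom (suc k) W)
Ins-onesFrom-0 {W} i with Ins-onesFrom-carry i | Ins-count i 0
... | inj₁ (refl , e) | c = trans c (sym (trans (cong (λ z → count 1 W ⊔ suc z) (sym e)) (m≤n⇒m⊔n≡n (n≤1+n _))))
... | inj₂ (ne , lt)  | c = trans c (trans (cong (_+ count 1 W) (δ-≢ ne)) (sym (m≥n⇒m⊔n≡m lt)))

-- Dropping letters in front of position `k` leaves an insertion, possibly with another final row,
-- so this reduces to the case of a whole word.
Ins-onesFrom-≤ : ∀ {W k r V} → Ins W k r V → ∀ {v} → v ≤ k → onesFrom v V ≡ onesFrom v W ⊔ suc (onesFrom (suc k) W)
Ins-onesFrom-≤ i          {zero}  _         = Ins-onesFrom-0 i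
Ins-onesFrom-≤ (bump i)   {suc v} (s≤s v≤k) = Ins-onesFrom-≤ i v≤k
Ins-onesFrom-≤ (pass _ i) {suc v} (s≤s v≤k) = Ins-onesFrom-≤ i v≤k

Ins-onesFrom-> : ∀ {W k r V} → Ins W k r V → ∀ {v} → k < v → onesFrom v V ≡ onesFrom v W
Ins-onesFrom-> mark       {suc v} _         = refl
Ins-onesFrom-> (bump i)   {suc v} (s≤s v≤k) = Ins-onesFrom-> i v≤k
Ins-onesFrom-> (pass _ i) {suc v} (s≤s v≤k) = Ins-onesFrom-> i v≤k

-- The Robinson-Schensted correspondence

-- Insertion runs from right to left and the value x goes to position x − 1. Words are also read from the end, so this
-- reverses both positions and values of σ, which preserves increasing subsequences.
data RS (n : ℕ) : List ℕ → List ℕ → List ℕ → Set where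
  []  : RS n [] (replicate n 0) []
  _∷_ : ∀ {σ P Q k r P'} → Ins P k r P' → RS n σ P Q → RS n (suc k ∷ σ) P' (r ∷ Q)

-- Schensted's theorem, refined by a threshold. A new value `suc k` at the front changes the number
-- of first-row entries above `v` by the recursion of `best`: a maximum with
-- `suc (onesFrom (suc k) P)` if `v ≤ k`, and no change if `k < v`.
RS-best : ∀ {n σ P Q} → RS n σ P Q → ∀ v → best v σ ≡ onesFrom v P
RS-best {n} [] v = sym (blank n v)
  where
  blank : ∀ n v → onesFrom v (replicate n 0) ≡ 0
  blank zero    zero    = refl
  blank zero    (suc v) = refl
  blank (suc n) zero    = blank n 0
  blank (suc n) (suc v) = blank n v
RS-best (_∷_ {k = k} i rs) v with v <ᵇ suc k in e
... | true  = trans (cong₂ (λ a b → a ⊔ suc b) (RS-best rs v) (RS-best rs (suc k)))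
  (sym (Ins-onesFrom-≤ i (s≤s⁻¹ (<ᵇ⇒< v (suc k) (subst T (sym e) tt)))))
... | false = trans (RS-best rs v) (sym (Ins-onesFrom-> i {v} (≰⇒> λ v≤k → subst T e (<⇒<ᵇ {v} (s≤s v≤k)))))

RS-functional : ∀ {n σ P P' Q Q'} → RS n σ P Q → RS n σ P' Q' → P ≡ P' × Q ≡ Q'
RS-functional [] [] = refl , refl
RS-functional (i ∷ x) (j ∷ y) with refl , refl ← RS-functional x y with refl , refl ← Ins-functional i j = refl , refl

RS-injective : ∀ {n σ σ' P Q} → RS n σ P Q → RS n σ' P Q → σ ≡ σ'
RS-injective [] [] = refl
RS-injective (i ∷ x) (j ∷ y) with refl , refl ← Ins-injective i j = cong (_ ∷_) (RS-injective x y)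

RS-lengthP : ∀ {n σ P Q} → RS n σ P Q → length P ≡ n
RS-lengthP []       = length-replicate _
RS-lengthP (i ∷ rs) = trans (Ins-length i) (RS-lengthP rs)

RS-lengthQ : ∀ {n σ P Q} → RS n σ P Q → length Q ≡ length σ
RS-lengthQ []       = refl
RS-lengthQ (i ∷ rs) = cong suc (RS-lengthQ rs)

count-replicate0 : ∀ t n → count (suc t) (replicate n 0) ≡ 0
count-replicate0 t zero    = refl
count-replicate0 t (suc n) = count-replicate0 t n

replicate0-lattice : ∀ n → Lattice (replicate n 0)
replicate0-lattice zero    = tt
replicate0-lattice (suc n) = (λ t → ≤-trans (≤-reflexive (count-replicate0 (suc t) n)) z≤n) , replicate0-lattice n

RS-shape : ∀ {n σ P Q} → RS n σ P Q → ∀ t → count (suc t) P ≡ count (suc t) Q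
RS-shape {n} []           t = count-replicate0 t n
RS-shape (_∷_ {r = r} i rs) t = trans (Ins-count i t) (cong (δ r (suc t) +_) (RS-shape rs t))

RS-latticeP : ∀ {n σ P Q} → RS n σ P Q → Lattice P
RS-latticeP {n} []   = replicate0-lattice n
RS-latticeP (i ∷ rs) = Ins-lattice i (RS-latticeP rs)

-- A suffix of `Q` records the insertion of a suffix of `σ`, so it has the shape of the insertion
-- word at that stage.
RS-latticeQ : ∀ {n σ P Q} → RS n σ P Q → Lattice Q
RS-latticeQ []              = tt
RS-latticeQ rs@(i ∷ rs') =
  (λ t → subst₂ _≤_ (RS-shape rs (suc t)) (RS-shape rs t) (Lattice⇒Part (RS-latticeP rs) t)) , RS-latticeQ rs'

RS-posQ : ∀ {n σ P Q} → RS n σ P Q → All (0 <_) Q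
RS-posQ []       = []
RS-posQ (i ∷ rs) = Ins-pos i ∷ RS-posQ rs

RS-blanks : ∀ {n σ P Q} → RS n σ P Q → count 0 P + length σ ≡ n
RS-blanks {n} [] = trans (+-identityʳ _) (blanks n)
  where
  blanks : ∀ n → count 0 (replicate n 0) ≡ n
  blanks zero    = refl
  blanks (suc n) = cong suc (blanks n)
RS-blanks {σ = _ ∷ σ} (i ∷ rs) = trans (+-suc _ (length σ)) (trans (cong (_+ length σ) (sym (Ins-count0 i))) (RS-blanks rs))

no-blanks⇒pos : ∀ {W} → count 0 W ≡ 0 → All (0 <_) W
no-blanks⇒pos {[]}        e = []
no-blanks⇒pos {suc s ∷ W} e = z<s ∷ no-blanks⇒pos e

pos⇒no-blanks : ∀ {W} → All (0 <_) W → count 0 W ≡ 0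
pos⇒no-blanks {[]}        _       = refl
pos⇒no-blanks {suc s ∷ W} (_ ∷ h) = pos⇒no-blanks h

all-blank : ∀ W → count 0 W ≡ length W → W ≡ replicate (length W) 0
all-blank []          _ = refl
all-blank (zero ∷ W)  e = cong (0 ∷_) (all-blank W (suc-injective e))
all-blank (suc s ∷ W) e = contradiction (subst (_≤ length W) e (count-≤-length W)) (<-irrefl refl)
  where
  count-≤-length : ∀ W → count 0 W ≤ length W
  count-≤-length []          = z≤n
  count-≤-length (zero ∷ W)  = s≤s (count-≤-length W)
  count-≤-length (suc s ∷ W) = m≤n⇒m≤1+n (count-≤-length W)

InRange : ℕ → ℕ → Set
InRange n x = 1 ≤ x × x ≤ n

RS-range : ∀ {n σ P Q} → RS n σ P Q → All (InRange n) σ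
RS-range [] = []
RS-range (i ∷ rs) = (z<s , subst (_ <_) (RS-lengthP rs) (Ins-index i)) ∷ RS-range rs

-- Filled positions are the values already inserted. Together with `RS-blank` this matches
-- distinctness of `σ` with the condition that each insertion finds a blank.
RS-filled : ∀ {n σ P Q k} → RS n σ P Q → suc k ∈ σ → ¬ Blank P k
RS-filled (i ∷ rs) (here refl) b = Ins-blank-fill i b
RS-filled (i ∷ rs) (there k∈σ) b = RS-filled rs k∈σ (Ins-blank⁻ i b)

RS-blank : ∀ {n σ P Q k} → RS n σ P Q → k < n → suc k ∉ σ → Blank P k
RS-blank [] k<n _ = blank k<n
  where
  blank : ∀ {n k} → k < n → Blank (replicate n 0) k
  blank {suc n} {zero}  _         = refl
  blank {suc n} {suc k} (s≤s k<n) = blank k<n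
RS-blank (i ∷ rs) k<n k∉σ = Ins-blank⁺ i (λ { refl → k∉σ (here refl) }) (RS-blank rs k<n (k∉σ ∘ there))

distinct⁺ : ∀ {x xs} → x ∉ xs → T (distinct xs) → T (distinct (x ∷ xs))
distinct⁺ {x} {xs} x∉xs d with any (λ y → x ≡ᵇ y) xs in e
... | false = d
... | true  = contradiction (Any.map (λ {y} → ≡ᵇ⇒≡ x y) (any⁻ (x ≡ᵇ_) xs (subst T (sym e) tt))) x∉xs

distinct⁻ : ∀ {x xs} → T (distinct (x ∷ xs)) → x ∉ xs × T (distinct xs)
distinct⁻ {x} {xs} d with any (λ y → x ≡ᵇ y) xs in e
... | false = (λ x∈xs → subst T e (any⁺ (x ≡ᵇ_) (Any.map (λ {y} → ≡⇒≡ᵇ x y) x∈xs))) , d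

RS-distinct : ∀ {n σ P Q} → RS n σ P Q → T (distinct σ)
RS-distinct [] = tt
RS-distinct (i ∷ rs) = distinct⁺ (λ k∈σ → RS-filled rs k∈σ (Ins-blank i)) (RS-distinct rs)

RS-total : ∀ {n σ} → All (InRange n) σ → T (distinct σ) → ∃₂ λ P Q → RS n σ P Q
RS-total {σ = []} _ _ = _ , _ , []
RS-total {σ = suc k ∷ σ} ((_ , k<n) ∷ h) d
  with k∉σ , d' ← distinct⁻ {suc k} {σ} d
  with P , Q , rs ← RS-total h d'
  with r , P' , i ← insert (RS-blank rs k<n k∉σ)
  = P' , r ∷ Q , i ∷ rs

-- Pairs of words of equal shape

record Words (n : ℕ) (P Q : List ℕ) : Set where
  field
    lengthP  : length P ≡ n
    lengthQ  : length Q ≡ n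
    latticeP : Lattice P
    latticeQ : Lattice Q
    posP     : All (0 <_) P
    posQ     : All (0 <_) Q
    shape    : ∀ t → count (suc t) P ≡ count (suc t) Q

RS⇒Words : ∀ {n σ P Q} → RS n σ P Q → length σ ≡ n → Words n P Q
RS⇒Words {n} {σ} {P} rs e = record
  { lengthP  = RS-lengthP rs
  ; lengthQ  = trans (RS-lengthQ rs) e
  ; latticeP = RS-latticeP rs
  ; latticeQ = RS-latticeQ rs
  ; posP     = no-blanks⇒pos (+-cancelʳ-≡ (length σ) (count 0 P) 0 (trans (RS-blanks rs) (sym e)))
  ; posQ     = RS-posQ rs
  ; shape    = RS-shape rs
  }

-- Insertion run backwards: the head of `Q` names the row that loses a cell. The intermediate words
-- contain blanks, so the induction keeps count of them in place of positivity of `P`.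
RS-onto : ∀ {P} Q → Lattice P → Lattice Q → All (0 <_) Q → (∀ t → count (suc t) P ≡ count (suc t) Q) →
  count 0 P + length Q ≡ length P → ∃ λ σ → RS (length P) σ P Q
RS-onto {P} [] _ _ _ _ e = [] , subst (λ W → RS (length P) [] W []) (sym (all-blank P (trans (sym (+-identityʳ _)) e))) []
RS-onto {P} (suc r ∷ Q) lP (_ , lQ) (_ ∷ h) sh e
  -- Equal shapes carry the corner condition over to `Q`: its head has just lengthened row `suc r`,
  -- and the rest of `Q` is a partition.
  with W , k , lW , i ← uninsert P r lP (subst₂ _<_
    (sym (trans (sh (suc r)) (cong (_+ count (2 + r) Q) (δ-≢ {r} {suc r} (1+n≢n ∘ sym)))))
    (sym (trans (sh r) (cong (_+ count (1 + r) Q) (δ-refl r)))) (s≤s (Lattice⇒Part lQ r)))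
  with σ , rs ← RS-onto Q lW lQ h (λ t → +-cancelˡ-≡ (δ r t) _ _ (trans (sym (Ins-count i t)) (sh t)))
    (trans (cong (_+ length Q) (Ins-count0 i)) (trans (sym (+-suc _ (length Q))) (trans e (Ins-length i))))
  = suc k ∷ σ , i ∷ subst (λ m → RS m σ W Q) (sym (Ins-length i)) rs

Words⇒RS : ∀ {n P Q} → Words n P Q → ∃ λ σ → RS n σ P Q
Words⇒RS {P = P} {Q} ws with refl ← Words.lengthP ws =
  RS-onto Q latticeP latticeQ posQ shape (trans (cong (_+ length Q) (pos⇒no-blanks posP)) lengthQ)
  where open Words ws

transpose-Words : ∀ {n P Q} → Words n P Q → Words n (transpose P) (transpose Q)
transpose-Words {P = P} {Q} ws = record
  { lengthP  = trans (transpose-length P) lengthP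
  ; lengthQ  = trans (transpose-length Q) lengthQ
  ; latticeP = transpose-lattice latticeP posP
  ; latticeQ = transpose-lattice latticeQ posQ
  ; posP     = transpose-pos P
  ; posQ     = transpose-pos Q
  ; shape    = transpose-shape latticeP latticeQ posP posQ shape
  }
  where open Words ws

∈⇒count : ∀ {s W} → s ∈ W → 0 < count s W
∈⇒count {s} (here refl) rewrite δ-refl s = z<s
∈⇒count {s} {x ∷ W} (there s∈W) = ≤-trans (∈⇒count s∈W) (m≤n+m _ (δ x s))

count-bound : ∀ {v W} → All (_< v) W → count v W ≡ 0
count-bound [] = refl
count-bound {v} {x ∷ W} (lt ∷ h) = cong₂ _+_ (δ-≢ (<⇒≢ lt)) (count-bound h)

letters≤ : ∀ {w W} → Part W → count (suc w) W ≡ 0 → All (_≤ w) W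
letters≤ {w} {W} p e = All.tabulate go
  where
  go : ∀ {s} → s ∈ W → s ≤ w
  go {zero}  _   = z≤n
  go {suc s} s∈W = ≰⇒> λ w≤s → contradiction (≤-trans (∈⇒count s∈W) (≤-trans (Part-antitone {W} p w≤s) (≤-reflexive e))) λ ()

-- The letters of `transpose W` are column numbers in a shape whose first row has `count 1 W` cells.
transpose-letters≤ : ∀ {w W} → Lattice W → All (0 <_) W → count 1 W ≤ w → All (_≤ w) (transpose W)
transpose-letters≤ {w} {W} l h le = letters≤ (transpose-part l h)
  (n≤0⇒n≡0 (≮⇒≥ λ lt → ≤⇒≯ le (Equivalence.from (transpose-cells l h 0 w) lt)))

transpose-letters≤⁻ : ∀ {w W} → Lattice W → All (0 <_) W → All (_≤ w) W → count 1 (transpose W) ≤ w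
transpose-letters≤⁻ {w} {W} l h b = ≮⇒≥ λ lt →
  contradiction (subst (0 <_) (count-bound (All.map s≤s b)) (Equivalence.from (transpose-cells l h w 0) lt)) λ ()

-- Sums and prefix counts

∑ : ℕ → (ℕ → ℕ) → ℕ
∑ zero    f = 0
∑ (suc n) f = ∑ n f + f n

∑-cong : ∀ n {f g} → (∀ {i} → i < n → f i ≡ g i) → ∑ n f ≡ ∑ n g
∑-cong zero    h = refl
∑-cong (suc n) h = cong₂ _+_ (∑-cong n (h ∘ m<n⇒m<1+n)) (h ≤-refl)

∑-+ : ∀ n f g → ∑ n (λ i → f i + g i) ≡ ∑ n f + ∑ n g
∑-+ zero    f g = refl
∑-+ (suc n) f g = trans (cong (_+ (f n + g n)) (∑-+ n f g)) (interchange +-commutativeSemigroup (∑ n f) (∑ n g) (f n) (g n))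

∑-cons : ∀ n f → ∑ (suc n) f ≡ f 0 + ∑ n (f ∘ suc)
∑-cons zero    f = +-comm 0 (f 0)
∑-cons (suc n) f = trans (cong (_+ f (suc n)) (∑-cons n f)) (+-assoc (f 0) _ _)

∑-zero : ∀ n {f} → (∀ {i} → i < n → f i ≡ 0) → ∑ n f ≡ 0
∑-zero zero    h = refl
∑-zero (suc n) h = cong₂ _+_ (∑-zero n (h ∘ m<n⇒m<1+n)) (h ≤-refl)

∑-one : ∀ n → ∑ n (λ _ → 1) ≡ n
∑-one zero    = refl
∑-one (suc n) = trans (+-comm _ 1) (cong suc (∑-one n))

∑-mono : ∀ f {m n} → m ≤ n → ∑ m f ≤ ∑ n f
∑-mono f m≤n = go (≤⇒≤′ m≤n)
  where
  go : ∀ {m n} → m ≤′ n → ∑ m f ≤ ∑ n f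
  go ≤′-refl     = ≤-refl
  go (≤′-step h) = m≤n⇒m≤n+o _ (go h)

∑-δ : ∀ {n a} → a < n → ∑ n (δ a) ≡ 1
∑-δ {suc n} {a} a<1+n with a ≟ n
... | yes refl = cong₂ _+_ (∑-zero n (λ i<n → δ-≢ (<⇒≢ i<n ∘ sym))) (δ-refl n)
... | no ne = cong₂ _+_ (∑-δ (≤∧≢⇒< (s≤s⁻¹ a<1+n) ne)) (δ-≢ ne)

-- The last index below `w` with a nonzero value. The default 0 is not reached when the values sum
-- to 1.
pick : ℕ → (ℕ → ℕ) → ℕ
pick zero    e = 0
pick (suc w) e = if e w ≡ᵇ 0 then pick w e else w

∑-≡0 : ∀ n {f} → ∑ n f ≡ 0 → ∀ {i} → i < n → f i ≡ 0
∑-≡0 (suc n) {f} h {i} i<1+n with i ≟ n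
... | yes refl = m+n≡0⇒n≡0 (∑ n f) h
... | no ne = ∑-≡0 n (m+n≡0⇒m≡0 (∑ n f) h) (≤∧≢⇒< (s≤s⁻¹ i<1+n) ne)

pick-spec : ∀ w e → ∑ w e ≡ 1 → pick w e < w × (∀ {c} → c < w → e c ≡ δ (pick w e) c)
pick-spec (suc w) e h with e w in ew
... | zero = m<n⇒m<1+n (proj₁ ih) , δs
  where
  ih = pick-spec w e (trans (sym (+-identityʳ _)) h)
  δs : ∀ {c} → c < suc w → e c ≡ δ (pick w e) c
  δs {c} c<1+w with c ≟ w
  ... | yes refl = trans ew (sym (δ-≢ (<⇒≢ (proj₁ ih))))
  ... | no ne = proj₂ ih (≤∧≢⇒< (s≤s⁻¹ c<1+w) ne)
... | suc x = ≤-refl , δs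
  where
  h' : ∑ w e + x ≡ 0
  h' = suc-injective (trans (sym (+-suc (∑ w e) x)) h)
  δs : ∀ {c} → c < suc w → e c ≡ δ w c
  δs {c} c<1+w with c ≟ w
  ... | yes refl = trans ew (trans (cong suc (m+n≡0⇒n≡0 (∑ w e) h')) (sym (δ-refl w)))
  ... | no ne = trans (∑-≡0 w (m+n≡0⇒m≡0 (∑ w e) h') (≤∧≢⇒< (s≤s⁻¹ c<1+w) ne)) (sym (δ-≢ (ne ∘ sym)))

δ-∸ : ∀ {w a c} → a < w → c < w → δ (w ∸ a) (w ∸ c) ≡ δ a c
δ-∸ {w} {a} {c} a<w c<w with a ≟ c
... | yes refl = trans (δ-refl (w ∸ a)) (sym (δ-refl a))
... | no ne = trans (δ-≢ (ne ∘ ∸-cancelˡ-≡ (<⇒≤ a<w) (<⇒≤ c<w))) (sym (δ-≢ ne))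

∸-range : ∀ {w s} → InRange w s → w ∸ s < w
∸-range {suc w} {suc s} _ = s≤s (m∸n≤m w s)

∑-δ-∸ : ∀ {w s} → InRange w s → ∑ w (λ c → δ s (w ∸ c)) ≡ 1
∑-δ-∸ {w} {s} h = trans
  (∑-cong w (λ {c} c<w → trans (cong (λ z → δ z (w ∸ c)) (sym (m∸[m∸n]≡n (proj₂ h)))) (δ-∸ (∸-range h) c<w)))
  (∑-δ (∸-range h))

below : ℕ → List ℕ → ℕ
below v []       = 0
below v (x ∷ xs) = 𝟙 (x ≤ᵇ v) + below v xs

𝟙-true : ∀ {b} → T b → 𝟙 b ≡ 1
𝟙-true {true} _ = refl

𝟙-false : ∀ {b} → ¬ T b → 𝟙 b ≡ 0
𝟙-false {true}  h = contradiction tt h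
𝟙-false {false} _ = refl

≤ᵇ-suc : ∀ x v → 𝟙 (x ≤ᵇ suc v) ≡ 𝟙 (x ≤ᵇ v) + δ x (suc v)
≤ᵇ-suc x v with <-cmp x (suc v)
... | tri< lt _ _ = trans (𝟙-true (≤⇒≤ᵇ (<⇒≤ lt))) (sym (cong₂ _+_ (𝟙-true (≤⇒≤ᵇ (s≤s⁻¹ lt))) (δ-≢ (<⇒≢ lt))))
... | tri≈ _ refl _ = trans (𝟙-true (≤⇒≤ᵇ (≤-refl {suc v}))) (sym (cong₂ _+_ (𝟙-false (<-irrefl refl ∘ ≤ᵇ⇒≤ (suc v) v)) (δ-refl v)))
... | tri> ¬lt ne gt = trans (𝟙-false (<⇒≱ gt ∘ ≤ᵇ⇒≤ x (suc v)))
  (sym (cong₂ _+_ (𝟙-false (<⇒≱ (<-trans (n<1+n v) gt) ∘ ≤ᵇ⇒≤ x v)) (δ-≢ ne)))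

below-suc : ∀ v xs → below (suc v) xs ≡ below v xs + count (suc v) xs
below-suc v []       = refl
below-suc v (x ∷ xs) = trans (cong₂ _+_ (≤ᵇ-suc x v) (below-suc v xs)) (interchange +-commutativeSemigroup (𝟙 (x ≤ᵇ v)) _ _ _)

below-∑ : ∀ {xs} → All (0 <_) xs → ∀ v → below v xs ≡ ∑ v (λ i → count (suc i) xs)
below-∑ {[]} [] zero = refl
below-∑ {x ∷ xs} (s≤s _ ∷ h) zero = below-∑ h zero
below-∑ {xs} h (suc v) = trans (below-suc v xs) (cong (_+ count (suc v) xs) (below-∑ h v))

below-all : ∀ {xs v} → All (_≤ v) xs → below v xs ≡ length xs
below-all []      = refl
below-all (h ∷ t) = cong₂ _+_ (𝟙-true (≤⇒≤ᵇ h)) (below-all t)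

-- For `D` the multiplicities in a column and `ℓ` its letter: each of the first `i` values either
-- lies in the column or is recorded as missing from it. More letters thus mean fewer entries.
complement-count : ∀ {n D p ℓ} → (∀ {i} → i < n → D i + δ (p i) ℓ ≡ 1) →
  ∀ {i} → i ≤ n → ∑ i D + count ℓ (applyDownFrom p i) ≡ i
complement-count h {zero}  _   = refl
complement-count {D = D} {p} {ℓ} h {suc i} i<n = trans (regroup (∑ i D) (D i) (δ (p i) ℓ) _)
  (cong₂ _+_ (h i<n) (complement-count h (<⇒≤ i<n)))
  where
  regroup : ∀ a b c d → (a + b) + (c + d) ≡ (b + c) + (a + d)
  regroup a b c d = trans (cong (_+ (c + d)) (+-comm a b)) (interchange +-commutativeSemigroup b a c d)

∸-suc : ∀ {m k} → k < m → m ∸ k ≡ suc (m ∸ suc k)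
∸-suc {suc m} {zero}  _         = refl
∸-suc {suc m} {suc k} (s≤s k<m) = ∸-suc k<m

-- Here a letter records presence, not absence: taking values off the top trades prefix sum for
-- letters and keeps the total.
suffix-count : ∀ {m n D q ℓ} → (∀ {j} → j < n → D (m ∸ suc j) ≡ δ (q j) ℓ) →
  ∀ {k} → k ≤ n → k ≤ m → ∑ (m ∸ k) D + count ℓ (applyDownFrom q k) ≡ ∑ m D
suffix-count h {zero} _ _ = +-identityʳ _
suffix-count {m} {n} {D} {q} {ℓ} h {suc k} k<n k<m = begin
  ∑ (m ∸ suc k) D + (δ (q k) ℓ + count ℓ (applyDownFrom q k))   ≡⟨ +-assoc (∑ (m ∸ suc k) D) _ _ ⟨
  ∑ (m ∸ suc k) D + δ (q k) ℓ + count ℓ (applyDownFrom q k)     ≡⟨ cong (λ z → ∑ (m ∸ suc k) D + z + _) (sym (h k<n)) ⟩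
  ∑ (suc (m ∸ suc k)) D + count ℓ (applyDownFrom q k)           ≡⟨ cong (λ z → ∑ z D + count ℓ (applyDownFrom q k)) (sym (∸-suc k<m)) ⟩
  ∑ (m ∸ k) D + count ℓ (applyDownFrom q k)                     ≡⟨ suffix-count h (<⇒≤ k<n) (<⇒≤ k<m) ⟩
  ∑ m D ∎
  where open ≡-Reasoning

applyDownFrom-lattice : ∀ {p} n → (∀ {i} → i ≤ n → Part (applyDownFrom p i)) → Lattice (applyDownFrom p n)
applyDownFrom-lattice zero    h = tt
applyDownFrom-lattice (suc n) h = h ≤-refl , applyDownFrom-lattice n (h ∘ m≤n⇒m≤1+n)

lattice-applyDownFrom : ∀ {p n} → Lattice (applyDownFrom p n) → ∀ {i} → i ≤ n → Part (applyDownFrom p i)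
lattice-applyDownFrom {p} {n} l i≤n = go (≤⇒≤′ i≤n) l
  where
  go : ∀ {i n} → i ≤′ n → Lattice (applyDownFrom p n) → Part (applyDownFrom p i)
  go ≤′-refl     l = Lattice⇒Part l
  go (≤′-step h) l = go h (proj₂ l)

-- Adjacent columns carry consecutive letters, the larger one on the left, so counts that weakly
-- grow from left to right form a partition.
columns⇒Part : ∀ {w X} → All (_≤ w) X → (∀ {c} → suc c < w → count (w ∸ c) X ≤ count (w ∸ suc c) X) → Part X
columns⇒Part {w} {X} b h t with 2 + t ≤? w
... | no nle = ≤-trans (≤-reflexive (count-bound (All.map (λ x≤w → ≤-trans (s≤s x≤w) (≰⇒> nle)) b))) z≤n
... | yes le = subst₂ (λ y z → count y X ≤ count z X) (m∸[m∸n]≡n le)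
  (trans (cong (w ∸_) (sym (∸-suc le))) (m∸[m∸n]≡n (<⇒≤ le)))
  (h (subst (_< w) (∸-suc le) (∸-range (z<s , <⇒≤ le))))

Part⇒columns : ∀ {w X} → Part X → ∀ {c} → suc c < w → count (w ∸ c) X ≤ count (w ∸ suc c) X
Part⇒columns {w} {X} p {c} lt = subst₂ (λ y z → count y X ≤ count z X)
  (sym (trans (∸-suc (<⇒≤ lt)) (cong suc (∸-suc lt)))) (sym (∸-suc lt)) (p (w ∸ suc (suc c)))

-- Tableaux and their columns

at : List ℕ → ℕ → ℕ
at []       _       = 0
at (x ∷ xs) zero    = x
at (x ∷ xs) (suc c) = at xs c

column : ℕ → List (List ℕ) → List ℕ
column c T = map (λ row → at row c) T

at-applyUpTo : ∀ f {n c} → c < n → at (applyUpTo f n) c ≡ f c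
at-applyUpTo f {suc n} {zero}  _         = refl
at-applyUpTo f {suc n} {suc c} (s≤s c<n) = at-applyUpTo (f ∘ suc) c<n

at-injective : ∀ {xs ys} → length xs ≡ length ys → (∀ {c} → c < length xs → at xs c ≡ at ys c) → xs ≡ ys
at-injective {[]}     {[]}     _ _ = refl
at-injective {x ∷ xs} {y ∷ ys} e h = cong₂ _∷_ (h z<s) (at-injective (suc-injective e) (h ∘ s<s))

All-at : ∀ {P : ℕ → Set} {xs} → All P xs → ∀ {c} → c < length xs → P (at xs c)
All-at (h ∷ _) {zero}  _       = h
All-at (_ ∷ t) {suc c} (s≤s l) = All-at t l

Linked-at : ∀ {xs} → Linked _≤_ xs → ∀ {c} → suc c < length xs → at xs c ≤ at xs (suc c)
Linked-at [-]     {c}     (s≤s ())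
Linked-at (h ∷ _) {zero}  _       = h
Linked-at (_ ∷ t) {suc c} (s≤s l) = Linked-at t l

countIn-columns : ∀ {w T} → All (λ row → length row ≡ w) T → ∀ v → countIn v T ≡ ∑ w (λ c → count v (column c T))
countIn-columns {w} [] v = sym (∑-zero w (λ _ → refl))
countIn-columns {w} {row ∷ T} (refl ∷ h) v =
  trans (cong₂ _+_ (count-row row) (countIn-columns h v)) (sym (∑-+ w (λ c → δ (at row c) v) (λ c → count v (column c T))))
  where
  count-row : ∀ xs → length (filterᵇ (λ x → x ≡ᵇ v) xs) ≡ ∑ (length xs) (λ c → δ (at xs c) v)
  count-row []       = refl
  count-row (x ∷ xs) = trans (head x) (trans (cong (δ x v +_) (count-row xs)) (sym (∑-cons (length xs) (λ c → δ (at (x ∷ xs) c) v))))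
    where
    head : ∀ x → length (filterᵇ (λ y → y ≡ᵇ v) (x ∷ xs)) ≡ δ x v + length (filterᵇ (λ y → y ≡ᵇ v) xs)
    head x with x ≡ᵇ v
    ... | true  = refl
    ... | false = refl

count-absent : ∀ {v xs} → All (v ≢_) xs → count v xs ≡ 0
count-absent []      = refl
count-absent (h ∷ t) = cong₂ _+_ (δ-≢ (h ∘ sym)) (count-absent t)

count-strict : ∀ {xs} → AllPairs _<_ xs → ∀ v → count v xs ≤ 1
count-strict [] v = z≤n
count-strict {x ∷ xs} (h ∷ t) v with x ≟ v
... | yes refl = ≤-reflexive (cong₂ _+_ (δ-refl x) (count-absent (All.map <⇒≢ h)))
... | no ne = subst (λ z → z + count v xs ≤ 1) (sym (δ-≢ ne)) (count-strict t v)

strict-unique : ∀ {xs ys} → AllPairs _<_ xs → AllPairs _<_ ys → (∀ v → count v xs ≡ count v ys) → xs ≡ ys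
strict-unique {[]} {[]} _ _ _ = refl
strict-unique {[]} {y ∷ ys} _ _ e = contradiction (trans (e y) (cong (_+ count y ys) (δ-refl y))) λ ()
strict-unique {x ∷ xs} {[]} _ _ e = contradiction (trans (sym (e x)) (cong (_+ count x xs) (δ-refl x))) λ ()
strict-unique {x ∷ xs} {y ∷ ys} (hx ∷ sx) (hy ∷ sy) e with <-cmp x y
... | tri< lt _ _ = contradiction
  (trans (sym (trans (e x) (count-absent (<⇒≢ lt ∷ All.map (λ y<z → <⇒≢ (<-trans lt y<z)) hy))))
    (cong (_+ count x xs) (δ-refl x))) λ ()
... | tri> _ _ gt = contradiction
  (trans (sym (trans (sym (e y)) (count-absent (<⇒≢ gt ∷ All.map (λ x<z → <⇒≢ (<-trans gt x<z)) hx))))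
    (cong (_+ count y ys) (δ-refl y))) λ ()
... | tri≈ _ refl _ = cong (x ∷_) (strict-unique sx sy (λ v → +-cancelˡ-≡ (δ x v) _ _ (e v)))

record Tableau (n w : ℕ) (T : List (List ℕ)) : Set where
  field
    height       : length T ≡ n
    widths       : All (λ row → length row ≡ w) T
    range        : All (All (InRange (n + n))) T
    rows         : All (Linked _≤_) T
    columns      : ∀ {c} → c < w → AllPairs _<_ (column c T)
    smallContent : ∀ {i} → i < n → countIn (suc i) T ≡ w ∸ 1
    largeContent : ∀ {i} → i < n → countIn (suc (n + i)) T ≡ 1

-- Columns are numbered 0, …, w − 1 from the left, and the letter l stands for column w − l. The value i + 1 ≤ n is
-- missing from column p i only, and the value 2n − j > n occurs in column q j only.
record Encodes (n w : ℕ) (T : List (List ℕ)) (p q : ℕ → ℕ) : Set where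
  field
    small : ∀ {c i} → c < w → i < n → count (suc i) (column c T) + δ (p i) (w ∸ c) ≡ 1
    large : ∀ {c j} → c < w → j < n → count (suc (n + n ∸ suc j)) (column c T) ≡ δ (q j) (w ∸ c)

All-column : ∀ {P : ℕ → Set} {w c} → c < w → ∀ {T} → All (λ row → length row ≡ w) T → All (All P) T → All P (column c T)
All-column c<w []         []      = []
All-column c<w (refl ∷ h) (a ∷ t) = All-at a c<w ∷ All-column c<w h t

columns-injective : ∀ {w T T'} → All (λ row → length row ≡ w) T → All (λ row → length row ≡ w) T' → length T ≡ length T' →
  (∀ {c} → c < w → column c T ≡ column c T') → T ≡ T'
columns-injective [] [] _ _ = refl
columns-injective (refl ∷ h) (e ∷ h') l cs = cong₂ _∷_ (at-injective (sym e) (λ c<w → ∷-injectiveˡ (cs c<w)))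
  (columns-injective h h' (suc-injective l) (λ c<w → ∷-injectiveʳ (cs c<w)))

reflect : ∀ {n j} → j < n → n + n ∸ suc j ≡ n + (n ∸ suc j)
reflect {n} j<n = +-∸-assoc n j<n

-- The upper half is indexed from the top, in the order in which the second word records it.
data Half (n : ℕ) : ℕ → Set where
  lower : ∀ {i} → i < n → Half n i
  upper : ∀ {j} → j < n → Half n (n + n ∸ suc j)

half : ∀ {n i} → i < n + n → Half n i
half {n} {i} i<2n with i <? n
... | yes i<n = lower i<n
... | no i≮n = subst (Half n) e (upper j<n)
  where
  j<n : n + n ∸ suc i < n
  j<n = subst (_≤ n) (∸-suc i<2n) (m≤n+o⇒m∸n≤o (n + n) i (+-monoˡ-≤ n (≮⇒≥ i≮n)))
  e : n + n ∸ suc (n + n ∸ suc i) ≡ i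
  e = trans (cong (n + n ∸_) (sym (∸-suc i<2n))) (m∸[m∸n]≡n (<⇒≤ i<2n))

-- A strict column is determined by the values it contains, and `p` and `q` decide this for every
-- value from 1 to `n + n`.
Encodes-injective : ∀ {n w T T' p q} → Tableau n w T → Tableau n w T' → Encodes n w T p q → Encodes n w T' p q → T ≡ T'
Encodes-injective {n} {w} {T} {T'} {p} {q} t t' e e' = columns-injective t.widths t'.widths (trans t.height (sym t'.height))
  λ c<w → strict-unique (t.columns c<w) (t'.columns c<w) (counts c<w)
  where
  module t = Tableau t
  module t' = Tableau t'
  module e = Encodes e
  module e' = Encodes e'
  counts : ∀ {c} → c < w → ∀ v → count v (column c T) ≡ count v (column c T')
  counts {c} c<w v with 1 ≤? v | v ≤? n + n
  counts {c} c<w (suc i) | yes _ | yes i<2n with half i<2n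
  ... | lower i<n = +-cancelʳ-≡ (δ (p i) (w ∸ c)) _ _ (trans (e.small c<w i<n) (sym (e'.small c<w i<n)))
  ... | upper j<n = trans (e.large c<w j<n) (sym (e'.large c<w j<n))
  counts c<w v | no v<1 | _ = trans (out t) (sym (out t'))
    where
    out : ∀ {T} → Tableau n w T → count v (column _ T) ≡ 0
    out t = count-absent (All.map (λ { (1≤x , _) refl → v<1 1≤x }) (All-column c<w (Tableau.widths t) (Tableau.range t)))
  counts c<w v | yes _ | no v>2n = trans (out t) (sym (out t'))
    where
    out : ∀ {T} → Tableau n w T → count v (column _ T) ≡ 0
    out t = count-absent (All.map (λ { (_ , x≤2n) refl → v>2n x≤2n }) (All-column c<w (Tableau.widths t) (Tableau.range t)))

∸-δ-determines : ∀ {w a b} → InRange w a → (∀ {c} → c < w → δ a (w ∸ c) ≡ δ b (w ∸ c)) → a ≡ b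
∸-δ-determines {w} {a} {b} r h = sym (δ≡1⇒≡ (trans (cong (δ b) (sym w-))
  (trans (sym (h (∸-range r))) (trans (cong (δ a) w-) (δ-refl a)))))
  where
  w- : w ∸ (w ∸ a) ≡ a
  w- = m∸[m∸n]≡n (proj₂ r)

Encodes-functional : ∀ {n w T p q p' q'} → Encodes n w T p q → Encodes n w T p' q' →
  (∀ {i} → i < n → InRange w (p i)) → (∀ {i} → i < n → InRange w (q i)) →
  (∀ {i} → i < n → p i ≡ p' i) × (∀ {i} → i < n → q i ≡ q' i)
Encodes-functional {T = T} e e' rp rq =
  (λ {i} i<n → ∸-δ-determines (rp i<n) (λ {c} c<w →
    +-cancelˡ-≡ (count (suc i) (column c T)) _ _ (trans (e.small c<w i<n) (sym (e'.small c<w i<n))))) ,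
  (λ i<n → ∸-δ-determines (rq i<n) (λ c<w → trans (sym (e.large c<w i<n)) (e'.large c<w i<n)))
  where
  module e = Encodes e
  module e' = Encodes e'

-- From tableaux to words

-- An entry at most `v` has a left neighbour at most `v`. In this form the row condition passes to
-- the words.
below-antitone : ∀ {w T c} → All (λ row → length row ≡ w) T → All (Linked _≤_) T → suc c < w →
  ∀ v → below v (column (suc c) T) ≤ below v (column c T)
below-antitone []         []      c<w v = z≤n
below-antitone (refl ∷ h) (l ∷ t) c<w v = +-mono-≤ (𝟙-≤ᵇ-antitone (Linked-at l c<w)) (below-antitone h t c<w v)
  where
  𝟙-≤ᵇ-antitone : ∀ {x y} → x ≤ y → 𝟙 (y ≤ᵇ v) ≤ 𝟙 (x ≤ᵇ v)
  𝟙-≤ᵇ-antitone {x} {y} x≤y with y ≤ᵇ v in e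
  ... | false = z≤n
  ... | true  = ≤-reflexive (sym (𝟙-true (≤⇒≤ᵇ (≤-trans x≤y (≤ᵇ⇒≤ y v (subst T (sym e) tt))))))

applyDownFrom-All : ∀ {P : ℕ → Set} {f n} → (∀ {i} → i < n → P (f i)) → All P (applyDownFrom f n)
applyDownFrom-All {f = f} {n} = All.applyDownFrom⁺₁ f n

All-applyDownFrom⁻ : ∀ {P : ℕ → Set} {f n} → All P (applyDownFrom f n) → ∀ {i} → i < n → P (f i)
All-applyDownFrom⁻ {n = suc n} (h ∷ t) {i} i<1+n with i ≟ n
... | yes refl = h
... | no ne    = All-applyDownFrom⁻ t (≤∧≢⇒< (s≤s⁻¹ i<1+n) ne)

shape-from-columns : ∀ {w X Y} → All (_≤ w) X → All (_≤ w) Y →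
  (∀ {c} → c < w → count (w ∸ c) X ≡ count (w ∸ c) Y) → ∀ t → count (suc t) X ≡ count (suc t) Y
shape-from-columns {w} {X} {Y} bX bY h t with suc t ≤? w
... | no nle = trans (absent bX) (sym (absent bY))
  where
  absent : ∀ {X} → All (_≤ w) X → count (suc t) X ≡ 0
  absent b = count-bound (All.map (λ x≤w → ≤-trans (s≤s x≤w) (≰⇒> nle)) b)
... | yes le = subst (λ z → count z X ≡ count z Y) (m∸[m∸n]≡n le) (h (∸-range (z<s , le)))

module Encode {n w T} (1≤w : 1 ≤ w) (t : Tableau n w T) where
  open Tableau t

  D : ℕ → ℕ → ℕ
  D c i = count (suc i) (column c T)

  D-small : ∀ {i} → i < n → ∑ w (λ c → 1 ∸ D c i) ≡ 1
  D-small {i} i<n = +-cancelʳ-≡ (w ∸ 1) _ _ (begin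
    ∑ w (λ c → 1 ∸ D c i) + (w ∸ 1)                ≡⟨ cong (∑ w (λ c → 1 ∸ D c i) +_) (smallContent i<n) ⟨
    ∑ w (λ c → 1 ∸ D c i) + countIn (suc i) T      ≡⟨ cong (∑ w (λ c → 1 ∸ D c i) +_) (countIn-columns widths (suc i)) ⟩
    ∑ w (λ c → 1 ∸ D c i) + ∑ w (λ c → D c i)      ≡⟨ ∑-+ w (λ c → 1 ∸ D c i) (λ c → D c i) ⟨
    -- A strict column contains a value at most once, so the truncated subtraction is exact.
    ∑ w (λ c → 1 ∸ D c i + D c i)                  ≡⟨ ∑-cong w (λ c<w → m∸n+n≡m (count-strict (columns c<w) (suc i))) ⟩
    ∑ w (λ _ → 1)                                  ≡⟨ ∑-one w ⟩
    w                                              ≡⟨ m+[n∸m]≡n 1≤w ⟨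
    1 + (w ∸ 1)                                    ∎)
    where open ≡-Reasoning

  D-large : ∀ {j} → j < n → ∑ w (λ c → D c (n + n ∸ suc j)) ≡ 1
  D-large {j} j<n = trans (sym (countIn-columns widths _))
    (trans (cong (λ z → countIn (suc z) T) (reflect j<n)) (largeContent (∸-range (z<s , j<n))))

  p q : ℕ → ℕ
  p i = w ∸ pick w (λ c → 1 ∸ D c i)
  q j = w ∸ pick w (λ c → D c (n + n ∸ suc j))

  ∸-InRange : ∀ {a} → a < w → InRange w (w ∸ a)
  ∸-InRange {a} a<w = m<n⇒0<n∸m a<w , m∸n≤m w a

  p-range : ∀ {i} → i < n → InRange w (p i)
  p-range i<n = ∸-InRange (proj₁ (pick-spec w _ (D-small i<n)))

  q-range : ∀ {j} → j < n → InRange w (q j)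
  q-range j<n = ∸-InRange (proj₁ (pick-spec w _ (D-large j<n)))

  encodes : Encodes n w T p q
  encodes .Encodes.small {c} {i} c<w i<n with lt , δs ← pick-spec w _ (D-small i<n) =
    trans (cong (D c i +_) (trans (δ-∸ lt c<w) (sym (δs c<w)))) (m+[n∸m]≡n (count-strict (columns c<w) (suc i)))
  encodes .Encodes.large c<w j<n with lt , δs ← pick-spec w _ (D-large j<n) = trans (δs c<w) (sym (δ-∸ lt c<w))

  P Q : List ℕ
  P = applyDownFrom p n
  Q = applyDownFrom q n

  positive : ∀ {c} → c < w → All (0 <_) (column c T)
  positive c<w = All.map proj₁ (All-column c<w widths range)

  full : ∀ {c} → c < w → ∑ (n + n) (D c) ≡ n
  full {c} c<w = trans (sym (below-∑ (positive c<w) (n + n)))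
    (trans (below-all (All.map proj₂ (All-column c<w widths range))) (trans (length-map (λ row → at row c) T) height))

  p-count : ∀ {c i} → c < w → i ≤ n → ∑ i (D c) + count (w ∸ c) (applyDownFrom p i) ≡ i
  p-count c<w = complement-count {p = p} (Encodes.small encodes c<w)

  q-count : ∀ {c i} → c < w → i ≤ n → ∑ (n + n ∸ i) (D c) + count (w ∸ c) (applyDownFrom q i) ≡ n
  q-count {c} c<w i≤n = trans (suffix-count {D = D c} {q = q} (Encodes.large encodes c<w) i≤n (m≤n⇒m≤n+o n i≤n)) (full c<w)

  D-antitone : ∀ {c} → suc c < w → ∀ v → ∑ v (D (suc c)) ≤ ∑ v (D c)
  D-antitone c<w v = subst₂ _≤_ (below-∑ (positive c<w) v) (below-∑ (positive (<⇒≤ c<w)) v) (below-antitone widths rows c<w v)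

  -- Prefix sum and letter count have the same total `m` in every column, so the letter counts grow
  -- to the right as the prefix sums fall. For the first word `v` and `m` are both `i`; for the
  -- second they are `n + n ∸ i` and `n`.
  part : ∀ {r k m} → (∀ {j} → j < k → InRange w (r j)) → ∀ v →
    (∀ {c} → c < w → ∑ v (D c) + count (w ∸ c) (applyDownFrom r k) ≡ m) → Part (applyDownFrom r k)
  part {r} {k} rr v e = columns⇒Part {w} {applyDownFrom r k} (applyDownFrom-All (proj₂ ∘ rr)) λ {c} c<w →
    +-cancelˡ-≤ (∑ v (D (suc c))) _ _ (≤-trans (+-monoˡ-≤ _ (D-antitone c<w v)) (≤-reflexive (trans (e (<⇒≤ c<w)) (sym (e c<w)))))

  words : Words n P Q
  words = record
    { lengthP  = length-applyDownFrom p n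
    ; lengthQ  = length-applyDownFrom q n
    ; latticeP = applyDownFrom-lattice n λ {i} i≤n → part (λ j<i → p-range (≤-trans j<i i≤n)) i (λ c<w → p-count c<w i≤n)
    ; latticeQ = applyDownFrom-lattice n λ {i} i≤n → part (λ j<i → q-range (≤-trans j<i i≤n)) (n + n ∸ i) (λ c<w → q-count c<w i≤n)
    ; posP     = applyDownFrom-All (proj₁ ∘ p-range)
    ; posQ     = applyDownFrom-All (proj₁ ∘ q-range)
    -- A column has `n` cells, so it lacks as many small values as it contains large ones.
    ; shape    = shape-from-columns (applyDownFrom-All (proj₂ ∘ p-range)) (applyDownFrom-All (proj₂ ∘ q-range)) λ {c} c<w →
        +-cancelˡ-≡ (∑ n (D c)) _ _ (trans (p-count c<w ≤-refl)
          (sym (subst (λ z → ∑ z (D c) + count (w ∸ c) Q ≡ n) (m+n∸n≡m n n) (q-count c<w ≤-refl))))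
    }

-- From words to tableaux

-- The least `v` with `a < N v`, or `m` if there is none below `m`. If `N v` counts the entries at
-- most `v` of a strict column, this is its entry in row `a`, counted from 0.
least : (ℕ → ℕ) → ℕ → ℕ → ℕ
least N zero    a = 0
least N (suc m) a = if a <ᵇ N 0 then 0 else suc (least (N ∘ suc) m a)

least-galois : ∀ {N} m {a} → (∀ {u v} → u ≤ v → N u ≤ N v) → a < N m → ∀ v → least N m a ≤ v ⇔ a < N v
least-galois {N} zero mono a<Nm v = mk⇔ (λ _ → ≤-trans a<Nm (mono z≤n)) (λ _ → z≤n)
least-galois {N} (suc m) {a} mono a<Nm v with a <ᵇ N 0 in e
... | true = mk⇔ (λ _ → ≤-trans (<ᵇ⇒< a (N 0) (subst T (sym e) tt)) (mono z≤n)) (λ _ → z≤n)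
least-galois {N} (suc m) {a} mono a<Nm zero    | false = mk⇔ (λ ()) (λ lt → ⊥-elim (subst T e (<⇒<ᵇ lt)))
least-galois {N} (suc m) {a} mono a<Nm (suc v) | false =
  mk⇔ (Equivalence.to ih ∘ s≤s⁻¹) (s≤s ∘ Equivalence.from ih)
  where ih = least-galois {N ∘ suc} m (mono ∘ s≤s) a<Nm v

below-galois : ∀ {f k} n v → (∀ {a} → a < n → f a ≤ v ⇔ a < k) → k ≤ n → below v (applyUpTo f n) ≡ k
below-galois {k = zero} zero v h k≤n = refl
below-galois {f} {zero} (suc n) v h k≤n = cong₂ _+_ (𝟙-false λ b → contradiction (Equivalence.to (h z<s) (≤ᵇ⇒≤ (f 0) v b)) λ ())
  (below-galois n v (λ a<n → mk⇔ (λ le → contradiction (Equivalence.to (h (s≤s a<n)) le) λ ()) λ ()) z≤n)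
below-galois {f} {suc k} (suc n) v h (s≤s k≤n) = cong₂ _+_ (𝟙-true (≤⇒≤ᵇ (Equivalence.from (h z<s) z<s)))
  (below-galois n v (λ a<n → ⇔-trans (h (s≤s a<n)) (mk⇔ s≤s⁻¹ s≤s)) k≤n)

applyUpTo-cong : ∀ {A : Set} {f g : ℕ → A} n → (∀ {i} → i < n → f i ≡ g i) → applyUpTo f n ≡ applyUpTo g n
applyUpTo-cong zero    h = refl
applyUpTo-cong (suc n) h = cong₂ _∷_ (h z<s) (applyUpTo-cong n (h ∘ s≤s))

δ≤1 : ∀ x v → δ x v ≤ 1
δ≤1 x v with x ≡ᵇ v
... | true  = ≤-refl
... | false = z≤n

module Decode {n w p q} (words : Words n (applyDownFrom p n) (applyDownFrom q n))
  (p≤w : All (_≤ w) (applyDownFrom p n)) (q≤w : All (_≤ w) (applyDownFrom q n)) where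
  open Words words

  p-range : ∀ {i} → i < n → InRange w (p i)
  p-range i<n = All-applyDownFrom⁻ posP i<n , All-applyDownFrom⁻ p≤w i<n

  q-range : ∀ {i} → i < n → InRange w (q i)
  q-range i<n = All-applyDownFrom⁻ posQ i<n , All-applyDownFrom⁻ q≤w i<n

  d : ℕ → ℕ → ℕ
  d c i = if i <ᵇ n then 1 ∸ δ (p i) (w ∸ c) else δ (q (n + n ∸ suc i)) (w ∸ c)

  d-small : ∀ c {i} → i < n → d c i + δ (p i) (w ∸ c) ≡ 1
  d-small c {i} i<n with i <ᵇ n in e
  ... | true  = m∸n+n≡m (δ≤1 (p i) (w ∸ c))
  ... | false = ⊥-elim (subst T e (<⇒<ᵇ i<n))

  d-large : ∀ c {j} → j < n → d c (n + n ∸ suc j) ≡ δ (q j) (w ∸ c)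
  d-large c {j} j<n with (n + n ∸ suc j) <ᵇ n in e
  ... | true = contradiction (≤-trans (<ᵇ⇒< _ n (subst T (sym e) tt)) (subst (n ≤_) (sym (reflect j<n)) (m≤m+n n _))) (<-irrefl refl)
  ... | false = cong (λ z → δ (q z) (w ∸ c)) (trans (cong (n + n ∸_) (sym (∸-suc j<2n))) (m∸[m∸n]≡n (<⇒≤ j<2n)))
    where
    j<2n : j < n + n
    j<2n = m≤n⇒m≤n+o n j<n

  d≤1 : ∀ c i → d c i ≤ 1
  d≤1 c i with i <ᵇ n
  ... | true  = m∸n≤m 1 (δ (p i) (w ∸ c))
  ... | false = δ≤1 (q (n + n ∸ suc i)) (w ∸ c)

  N : ℕ → ℕ → ℕ
  N c v = ∑ v (d c)

  p-count : ∀ c {i} → i ≤ n → N c i + count (w ∸ c) (applyDownFrom p i) ≡ i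
  p-count c = complement-count {D = d c} {p} (d-small c)

  q-count' : ∀ c {i} → i ≤ n → N c (n + n ∸ i) + count (w ∸ c) (applyDownFrom q i) ≡ N c (n + n)
  q-count' c i≤n = suffix-count {D = d c} {q} (d-large c) i≤n (m≤n⇒m≤n+o n i≤n)

  -- By equality of contents, the large values exactly make up for the missing small ones.
  full : ∀ {c} → c < w → N c (n + n) ≡ n
  full {c} c<w = trans (sym (q-count' c ≤-refl)) (trans (cong₂ (λ x y → N c x + y) (m+n∸n≡m n n)
    (sym (subst (λ z → count z (applyDownFrom p n) ≡ count z (applyDownFrom q n)) (sym (∸-suc c<w)) (shape (w ∸ suc c)))))
    (p-count c ≤-refl))

  q-count : ∀ {c i} → c < w → i ≤ n → N c (n + n ∸ i) + count (w ∸ c) (applyDownFrom q i) ≡ n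
  q-count {c} c<w i≤n = trans (q-count' c i≤n) (full c<w)

  cancel : ∀ {a b x y m} → a + x ≡ m → b + y ≡ m → y ≤ x → a ≤ b
  cancel {a} {b} {x} {y} e e' y≤x = +-cancelʳ-≤ y _ _ (≤-trans (+-monoʳ-≤ a y≤x) (≤-reflexive (trans e (sym e'))))

  -- Up to `n` this is the lattice property of the first word. Above `n` it is that of the second,
  -- read down from full columns of equal length: the column with more letters keeps fewer entries.
  N-antitone : ∀ {c} → suc c < w → ∀ {v} → v ≤ n + n → N (suc c) v ≤ N c v
  N-antitone {c} c<w {v} v≤2n with v ≤? n
  ... | yes v≤n = cancel (p-count (suc c) v≤n) (p-count c v≤n)
    (Part⇒columns {X = applyDownFrom p v} (lattice-applyDownFrom latticeP v≤n) c<w)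
  ... | no v≰n = subst (λ z → N (suc c) z ≤ N c z) (m∸[m∸n]≡n v≤2n)
    (cancel (q-count c<w j≤n) (q-count (<⇒≤ c<w) j≤n)
      (Part⇒columns {X = applyDownFrom q (n + n ∸ v)} (lattice-applyDownFrom latticeQ j≤n) c<w))
    where
    j≤n : n + n ∸ v ≤ n
    j≤n = m≤n+o⇒m∸n≤o (n + n) v (+-monoˡ-≤ n (<⇒≤ (≰⇒> v≰n)))

  entry : ℕ → ℕ → ℕ
  entry a c = least (N c) (n + n) a

  galois : ∀ {a c} → a < n → c < w → ∀ v → entry a c ≤ v ⇔ a < N c v
  galois {a} {c} a<n c<w = least-galois (n + n) (∑-mono (d c)) (subst (a <_) (sym (full c<w)) a<n)

  entry-< : ∀ {a c} → a < n → c < w → a < N c (entry a c)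
  entry-< a<n c<w = Equivalence.to (galois a<n c<w _) ≤-refl

  entry-range : ∀ {a c} → a < n → c < w → InRange (n + n) (entry a c)
  entry-range {a} {c} a<n c<w = ≰⇒> (λ le → contradiction (Equivalence.to (galois a<n c<w 0) le) λ ()) ,
    Equivalence.from (galois a<n c<w (n + n)) (subst (a <_) (sym (full c<w)) a<n)

  entry-row : ∀ {a c} → a < n → suc c < w → entry a c ≤ entry a (suc c)
  entry-row a<n c<w = Equivalence.from (galois a<n (<⇒≤ c<w) _)
    (≤-trans (entry-< a<n c<w) (N-antitone c<w (proj₂ (entry-range a<n c<w))))

  -- Each value adds at most one entry to a column, so `N c` cannot pass the thresholds `a` and
  -- `suc a` at the same value.
  entry-column : ∀ {a c} → suc a < n → c < w → entry a c < entry (suc a) c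
  entry-column {a} {c} a<n c<w with entry (suc a) c | entry-< a<n c<w
  ... | suc v | lt = s≤s (Equivalence.from (galois (<⇒≤ a<n) c<w v)
    (s≤s⁻¹ (≤-trans lt (≤-trans (+-monoʳ-≤ (N c v) (d≤1 c v)) (≤-reflexive (+-comm (N c v) 1))))))

  tableau : List (List ℕ)
  tableau = applyUpTo (λ a → applyUpTo (entry a) w) n

  column-tableau : ∀ {c} → c < w → column c tableau ≡ applyUpTo (λ a → entry a c) n
  column-tableau {c} c<w = trans (map-applyUpTo (λ a → applyUpTo (entry a) w) (λ row → at row c) n)
    (applyUpTo-cong n (λ {a} _ → at-applyUpTo (entry a) c<w))

  below-column : ∀ {c v} → c < w → v ≤ n + n → below v (column c tableau) ≡ N c v
  below-column {c} {v} c<w v≤2n = trans (cong (below v) (column-tableau c<w))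
    (below-galois n v (λ a<n → galois a<n c<w v) (subst (N c v ≤_) (full c<w) (∑-mono (d c) v≤2n)))

  count-column : ∀ {c i} → c < w → i < n + n → count (suc i) (column c tableau) ≡ d c i
  count-column {c} {i} c<w i<2n = +-cancelˡ-≡ (N c i) _ _
    (trans (cong (_+ count (suc i) (column c tableau)) (sym (below-column c<w (<⇒≤ i<2n))))
    (trans (sym (below-suc i (column c tableau))) (below-column c<w i<2n)))

  widths' : All (λ row → length row ≡ w) tableau
  widths' = All.applyUpTo⁺₁ _ n (λ {a} _ → length-applyUpTo (entry a) w)

  content : ∀ {i} → i < n + n → countIn (suc i) tableau ≡ ∑ w (λ c → d c i)
  content i<2n = trans (countIn-columns widths' _) (∑-cong w (λ c<w → count-column c<w i<2n))

  isTableau : 1 ≤ w → Tableau n w tableau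
  isTableau 1≤w = record
    { height       = length-applyUpTo _ n
    ; widths       = widths'
    ; range        = All.applyUpTo⁺₁ _ n (λ a<n → All.applyUpTo⁺₁ _ w (entry-range a<n))
    ; rows         = All.applyUpTo⁺₁ _ n (λ a<n → Linked.applyUpTo⁺₁ _ w (entry-row a<n))
    ; columns      = λ {c} c<w → Linked.Linked⇒AllPairs <-trans
        (subst (Linked _<_) (sym (column-tableau c<w)) (Linked.applyUpTo⁺₁ _ n (λ a<n → entry-column a<n c<w)))
    ; smallContent = λ {i} i<n → trans (content (m≤n⇒m≤n+o n i<n)) (+-cancelʳ-≡ 1 _ _ (begin
        ∑ w (λ c → d c i) + 1                              ≡⟨ cong (∑ w (λ c → d c i) +_) (∑-δ-∸ (p-range i<n)) ⟨
        ∑ w (λ c → d c i) + ∑ w (λ c → δ (p i) (w ∸ c))    ≡⟨ ∑-+ w (λ c → d c i) (λ c → δ (p i) (w ∸ c)) ⟨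
        ∑ w (λ c → d c i + δ (p i) (w ∸ c))                ≡⟨ ∑-cong w (λ {c} _ → d-small c i<n) ⟩
        ∑ w (λ _ → 1)                                      ≡⟨ ∑-one w ⟩
        w                                                  ≡⟨ m∸n+n≡m 1≤w ⟨
        w ∸ 1 + 1                                          ∎))
    ; largeContent = λ {i} i<n → let j<n = ∸-range (z<s , i<n) in
        trans (content (+-monoʳ-< n i<n))
          (trans (∑-cong w (λ {c} _ → trans (cong (d c) (sym (double-reflect i<n))) (d-large c j<n)))
            (∑-δ-∸ (q-range j<n)))
    }
    where
    open ≡-Reasoning
    double-reflect : ∀ {i} → i < n → n + n ∸ suc (n ∸ suc i) ≡ n + i
    double-reflect {i} i<n = trans (cong (n + n ∸_) (sym (∸-suc i<n)))
      (trans (+-∸-assoc n (m∸n≤m n i)) (cong (n +_) (m∸[m∸n]≡n (<⇒≤ i<n))))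

  encodes : Encodes n w tableau p q
  encodes = record
    { small = λ {c} {i} c<w i<n → trans (cong (_+ δ (p i) (w ∸ c)) (count-column c<w (m≤n⇒m≤n+o n i<n))) (d-small c i<n)
    ; large = λ {c} {j} c<w j<n → trans (count-column c<w (subst (_≤ n + n) (∸-suc (m≤n⇒m≤n+o n j<n)) (m∸n≤m (n + n) j))) (d-large c j<n)
    }

-- Comparing and enumerating finite lists

-- A pigeonhole principle for a relation in place of a function, so that one relation read in both
-- directions yields both inequalities.
length-≤ : ∀ {A B : Set} (R : A → B → Set) {xs ys} → Unique xs →
  (∀ {x} → x ∈ xs → ∃ λ y → y ∈ ys × R x y) →
  (∀ {x x' y} → x ∈ xs → x' ∈ xs → R x y → R x' y → x ≡ x') → length xs ≤ length ys
length-≤ R {[]} _ _ _ = z≤n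
length-≤ R {x ∷ xs} (x∉ ∷ u) f inj with y , y∈ys , r ← f (here refl) with ys₁ , ys₂ , refl ← ∈-∃++ y∈ys =
  subst (suc (length xs) ≤_) (sym (trans (length-++ ys₁) (trans (+-suc (length ys₁) _) (cong suc (sym (length-++ ys₁))))))
    (s≤s (length-≤ R u f' (λ x∈ x'∈ → inj (there x∈) (there x'∈))))
  where
  f' : ∀ {x'} → x' ∈ xs → ∃ λ y' → y' ∈ ys₁ ++ ys₂ × R x' y'
  f' x'∈ with y' , y'∈ , r' ← f (there x'∈) with ∈-++⁻ ys₁ y'∈
  ... | inj₁ h = y' , ∈-++⁺ˡ h , r'
  ... | inj₂ (there h) = y' , ∈-++⁺ʳ ys₁ h , r'
  -- No later element can need the removed `y`: injectivity would make it equal to `x`, which does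
  -- not recur in `xs`.
  ... | inj₂ (here refl) = contradiction (inj (here refl) (there x'∈) r r') (All.lookup x∉ x'∈)

prepend : ∀ {A : Set} → List A → List (List A) → List (List A)
prepend xs yss = concatMap (λ x → map (x ∷_) yss) xs

prepend-product : ∀ {A : Set} (xs : List A) (yss : List (List A)) → prepend xs yss ≡ cartesianProductWith _∷_ xs yss
prepend-product []       yss = refl
prepend-product (x ∷ xs) yss = cong (map (x ∷_) yss ++_) (prepend-product xs yss)

Unique-prepend : ∀ {A : Set} {xs : List A} {yss} → Unique xs → Unique yss → Unique (prepend xs yss)
Unique-prepend {xs = xs} {yss} u v = subst Unique (sym (prepend-product xs yss)) (Unique.cartesianProductWith⁺ _∷_ ∷-injective u v)

∈-prepend⁺ : ∀ {A : Set} {xs : List A} {yss x ys} → x ∈ xs → ys ∈ yss → x ∷ ys ∈ prepend xs yss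
∈-prepend⁺ {xs = xs} {yss} p q = subst (_ ∈_) (sym (prepend-product xs yss)) (∈-cartesianProductWith⁺ _∷_ p q)

∈-prepend⁻ : ∀ {A : Set} (xs : List A) yss {zs} → zs ∈ prepend xs yss →
  ∃₂ λ x ys → x ∈ xs × ys ∈ yss × zs ≡ x ∷ ys
∈-prepend⁻ xs yss p = ∈-cartesianProductWith⁻ _∷_ xs yss (subst (_ ∈_) (prepend-product xs yss) p)

∈-oneTo⁺ : ∀ {m x} → InRange m x → x ∈ oneTo m
∈-oneTo⁺ {x = suc x} (_ , le) = ∈-map⁺ suc (∈-upTo⁺ le)

∈-oneTo⁻ : ∀ {m x} → x ∈ oneTo m → InRange m x
∈-oneTo⁻ p with _ , q , refl ← ∈-map⁻ suc p = z<s , ∈-upTo⁻ q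

Unique-oneTo : ∀ m → Unique (oneTo m)
Unique-oneTo m = Unique.map⁺ suc-injective (Unique.upTo⁺ m)

Unique-allLists : ∀ m k → Unique (allLists m k)
Unique-allLists m zero    = [] ∷ []
Unique-allLists m (suc k) = Unique-prepend (Unique-oneTo m) (Unique-allLists m k)

Unique-fillings : ∀ m rs → Unique (fillings m rs)
Unique-fillings m []       = [] ∷ []
Unique-fillings m (r ∷ rs) = Unique-prepend (Unique-allLists m r) (Unique-fillings m rs)

∈-allLists⁺ : ∀ {m xs} → All (InRange m) xs → xs ∈ allLists m (length xs)
∈-allLists⁺ []      = here refl
∈-allLists⁺ (h ∷ t) = ∈-prepend⁺ (∈-oneTo⁺ h) (∈-allLists⁺ t)

∈-allLists⁻ : ∀ {m} k {xs} → xs ∈ allLists m k → length xs ≡ k × All (InRange m) xs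
∈-allLists⁻ zero (here refl) = refl , []
∈-allLists⁻ {m} (suc k) p with x , ys , q , r , refl ← ∈-prepend⁻ (oneTo m) (allLists m k) p with e , h ← ∈-allLists⁻ k r =
  cong suc e , ∈-oneTo⁻ q ∷ h

∈-fillings⁺ : ∀ {m w T} → All (λ row → length row ≡ w) T → All (All (InRange m)) T → T ∈ fillings m (replicate (length T) w)
∈-fillings⁺ []         []      = here refl
∈-fillings⁺ (refl ∷ e) (h ∷ t) = ∈-prepend⁺ (∈-allLists⁺ h) (∈-fillings⁺ e t)

∈-fillings⁻ : ∀ {m w} n {T} → T ∈ fillings m (replicate n w) →
  length T ≡ n × All (λ row → length row ≡ w) T × All (All (InRange m)) T
∈-fillings⁻ zero (here refl) = refl , [] , []
∈-fillings⁻ {m} {w} (suc n) p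
  with row , T , q , r , refl ← ∈-prepend⁻ (allLists m w) (fillings m (replicate n w)) p
  with e , h ← ∈-allLists⁻ w q | l , es , hs ← ∈-fillings⁻ n r = cong suc l , e ∷ es , h ∷ hs

∧⁺ : ∀ {x y} → T x → T y → T (x ∧ y)
∧⁺ a b = Equivalence.from T-∧ (a , b)

∧⁻ : ∀ {x y} → T (x ∧ y) → T x × T y
∧⁻ = Equivalence.to T-∧

weaklyIncreasing⁺ : ∀ {xs} → Linked _≤_ xs → T (weaklyIncreasing xs)
weaklyIncreasing⁺ []      = tt
weaklyIncreasing⁺ [-]     = tt
weaklyIncreasing⁺ (h ∷ t) = ∧⁺ (≤⇒≤ᵇ h) (weaklyIncreasing⁺ t)

weaklyIncreasing⁻ : ∀ xs → T (weaklyIncreasing xs) → Linked _≤_ xs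
weaklyIncreasing⁻ []           _ = []
weaklyIncreasing⁻ (x ∷ [])     _ = [-]
weaklyIncreasing⁻ (x ∷ y ∷ xs) h = ≤ᵇ⇒≤ x y (proj₁ (∧⁻ h)) ∷ weaklyIncreasing⁻ (y ∷ xs) (proj₂ (∧⁻ {x ≤ᵇ y} h))

zipWith-<ᵇ⁺ : ∀ xs ys → length xs ≡ length ys → (∀ {c} → c < length xs → at xs c < at ys c) → T (and (zipWith _<ᵇ_ xs ys))
zipWith-<ᵇ⁺ []       []       _ _ = tt
zipWith-<ᵇ⁺ (x ∷ xs) (y ∷ ys) e h = ∧⁺ (<⇒<ᵇ (h z<s)) (zipWith-<ᵇ⁺ xs ys (suc-injective e) (h ∘ s≤s))

zipWith-<ᵇ⁻ : ∀ xs ys → length xs ≡ length ys → T (and (zipWith _<ᵇ_ xs ys)) → ∀ {c} → c < length xs → at xs c < at ys c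
zipWith-<ᵇ⁻ (x ∷ xs) (y ∷ ys) e h {zero}  _       = <ᵇ⇒< x y (proj₁ (∧⁻ {x <ᵇ y} h))
zipWith-<ᵇ⁻ (x ∷ xs) (y ∷ ys) e h {suc c} (s≤s l) = zipWith-<ᵇ⁻ xs ys (suc-injective e) (proj₂ (∧⁻ {x <ᵇ y} h)) l

columnsStrict⁺ : ∀ {w T'} → All (λ row → length row ≡ w) T' → (∀ {c} → c < w → Linked _<_ (column c T')) → T (columnsStrict T')
columnsStrict⁺ {T' = []}     _ _ = tt
columnsStrict⁺ {T' = r ∷ []} _ _ = tt
columnsStrict⁺ {T' = r ∷ r' ∷ rs} (refl ∷ e ∷ es) h =
  ∧⁺ (zipWith-<ᵇ⁺ r r' (sym e) (Linked.head ∘ h)) (columnsStrict⁺ (e ∷ es) (Linked.tail ∘ h))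

columnsStrict⁻ : ∀ {w T'} → All (λ row → length row ≡ w) T' → T (columnsStrict T') → ∀ {c} → c < w → Linked _<_ (column c T')
columnsStrict⁻ {T' = []}     _ _ _ = []
columnsStrict⁻ {T' = r ∷ []} _ _ _ = [-]
columnsStrict⁻ {T' = r ∷ r' ∷ rs} (refl ∷ e ∷ es) h c<w =
  zipWith-<ᵇ⁻ r r' (sym e) (proj₁ (∧⁻ h)) c<w ∷ columnsStrict⁻ (e ∷ es) (proj₂ (∧⁻ {and (zipWith _<ᵇ_ r r')} h)) c<w

hasContentFrom⁺ : ∀ i k {c μ T'} → (∀ {j} → j < k → countIn (i + j) T' ≡ c) → T (hasContentFrom (i + k) μ T') →
  T (hasContentFrom i (replicate k c ++ μ) T')
hasContentFrom⁺ i zero    {μ = μ} {T'} h r = subst (λ z → T (hasContentFrom z μ T')) (+-identityʳ i) r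
hasContentFrom⁺ i (suc k) {c} {μ} {T'} h r = ∧⁺ (≡⇒≡ᵇ _ _ (trans (cong (λ z → countIn z T') (sym (+-identityʳ i))) (h z<s)))
  (hasContentFrom⁺ (suc i) k (λ {j} j<k → trans (cong (λ z → countIn z T') (sym (+-suc i j))) (h (s≤s j<k)))
    (subst (λ z → T (hasContentFrom z μ T')) (+-suc i k) r))

hasContentFrom⁻ : ∀ i k {c μ T'} → T (hasContentFrom i (replicate k c ++ μ) T') →
  (∀ {j} → j < k → countIn (i + j) T' ≡ c) × T (hasContentFrom (i + k) μ T')
hasContentFrom⁻ i zero    {μ = μ} {T'} h = (λ ()) , subst (λ z → T (hasContentFrom z μ T')) (sym (+-identityʳ i)) h
hasContentFrom⁻ i (suc k) {c} {μ} {T'} h with a , b ← ∧⁻ {countIn i T' ≡ᵇ c} h with f , r ← hasContentFrom⁻ (suc i) k b =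
  counts , subst (λ z → T (hasContentFrom z μ T')) (sym (+-suc i k)) r
  where
  counts : ∀ {j} → j < suc k → countIn (i + j) T' ≡ c
  counts {zero}  _         = trans (cong (λ z → countIn z T') (+-identityʳ i)) (≡ᵇ⇒≡ _ c a)
  counts {suc j} (s≤s j<k) = trans (cong (λ z → countIn z T') (+-suc i j)) (f j<k)

content : ℕ → ℕ → List ℕ
content n w = replicate n (w ∸ 1) ++ replicate n 1

length-content : ∀ n w → length (content n w) ≡ n + n
length-content n w = trans (length-++ (replicate n (w ∸ 1))) (cong₂ _+_ (length-replicate n) (length-replicate n))

tableaux : ℕ → ℕ → List (List (List ℕ))
tableaux n w = filterᵇ (λ T → isSSYT T ∧ hasContent (content n w) T) (fillings (length (content n w)) (replicate n w))

tableaux⁻ : ∀ {n w T} → T ∈ tableaux n w → Tableau n w T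
tableaux⁻ {n} {w} {T'} p
  with p∈ , b ← ∈-filter⁻ (T? ∘ λ T → isSSYT T ∧ hasContent (content n w) T)
    {xs = fillings (length (content n w)) (replicate n w)} p
  with l , es , hs ← ∈-fillings⁻ n p∈
  with ss , ct ← ∧⁻ {isSSYT T'} b
  with ri , cs ← ∧⁻ ss
  with sc , ct' ← hasContentFrom⁻ 1 n ct
  -- The second block ends the content vector; an empty tail is appended to give it the form of a
  -- block followed by a rest.
  with lc , _ ← hasContentFrom⁻ (suc n) n {μ = []}
    (subst (λ z → T (hasContentFrom (suc n) z T')) (sym (++-identityʳ (replicate n 1))) ct')
  = record
  { height       = l
  ; widths       = es
  ; range        = subst (λ m → All (All (InRange m)) T') (length-content n w) hs
  ; rows         = All.map (λ {r} → weaklyIncreasing⁻ r) (All.all⁺ weaklyIncreasing T' ri)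
  ; columns      = λ c<w → Linked.Linked⇒AllPairs <-trans (columnsStrict⁻ es cs c<w)
  ; smallContent = sc
  ; largeContent = lc
  }

tableaux⁺ : ∀ {n w T} → Tableau n w T → T ∈ tableaux n w
tableaux⁺ {n} {w} {T'} t = ∈-filter⁺ (T? ∘ λ T → isSSYT T ∧ hasContent (content n w) T)
  (subst (λ k → T' ∈ fillings (length (content n w)) (replicate k w)) height
    (∈-fillings⁺ widths (subst (λ m → All (All (InRange m)) T') (sym (length-content n w)) range)))
  (∧⁺ (∧⁺ (All.all⁻ weaklyIncreasing (All.map weaklyIncreasing⁺ rows))
          (columnsStrict⁺ widths (λ c<w → Linked.AllPairs⇒Linked (columns c<w))))
      (hasContentFrom⁺ 1 n smallContent
        (subst (λ z → T (hasContentFrom (suc n) z T')) (++-identityʳ (replicate n 1))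
          (hasContentFrom⁺ (suc n) n {μ = []} largeContent tt))))
  where open Tableau t

bounded : ℕ → ℕ → List (List ℕ)
bounded n w = filterᵇ (λ σ → lis σ ≤ᵇ w) (permutations n)

record Bounded (n w : ℕ) (σ : List ℕ) : Set where
  field
    size     : length σ ≡ n
    entries  : All (InRange n) σ
    noRepeat : T (distinct σ)
    short    : lis σ ≤ w

bounded⁻ : ∀ {n w σ} → σ ∈ bounded n w → Bounded n w σ
bounded⁻ {n} {w} {σ} p
  with p∈ , b ← ∈-filter⁻ (T? ∘ λ σ → lis σ ≤ᵇ w) {xs = permutations n} p
  with p∈' , d ← ∈-filter⁻ (T? ∘ distinct) {xs = allLists n n} p∈
  with e , h ← ∈-allLists⁻ n p∈'
  = record { size = e ; entries = h ; noRepeat = d ; short = ≤ᵇ⇒≤ (lis σ) w b }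

bounded⁺ : ∀ {n w σ} → Bounded n w σ → σ ∈ bounded n w
bounded⁺ {n} {w} {σ} b = ∈-filter⁺ (T? ∘ λ σ → lis σ ≤ᵇ w)
  (∈-filter⁺ (T? ∘ distinct) (subst (λ k → σ ∈ allLists n k) size (∈-allLists⁺ entries)) noRepeat) (≤⇒≤ᵇ short)
  where open Bounded b

-- The correspondence between tableaux and permutations

-- Indices count from the end of the word, so that `applyDownFrom` is inverted: encodings are
-- functions, while insertion acts on lists.
letter : List ℕ → ℕ → ℕ
letter []      i = 0
letter (s ∷ W) i = if i ≡ᵇ length W then s else letter W i

applyDownFrom-cong : ∀ {f g : ℕ → ℕ} n → (∀ {i} → i < n → f i ≡ g i) → applyDownFrom f n ≡ applyDownFrom g n
applyDownFrom-cong zero    h = refl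
applyDownFrom-cong (suc n) h = cong₂ _∷_ (h ≤-refl) (applyDownFrom-cong n (h ∘ m<n⇒m<1+n))

letter-last : ∀ s W → letter (s ∷ W) (length W) ≡ s
letter-last s W with length W ≡ᵇ length W in e
... | true  = refl
... | false = ⊥-elim (subst T e (≡⇒≡ᵇ (length W) (length W) refl))

letter-tail : ∀ s W {i} → i < length W → letter (s ∷ W) i ≡ letter W i
letter-tail s W {i} lt with i ≡ᵇ length W in e
... | true  = contradiction (≡ᵇ⇒≡ i (length W) (subst T (sym e) tt)) (<⇒≢ lt)
... | false = refl

applyDownFrom-letter : ∀ W → applyDownFrom (letter W) (length W) ≡ W
applyDownFrom-letter []      = refl
applyDownFrom-letter (s ∷ W) = cong₂ _∷_ (letter-last s W)
  (trans (applyDownFrom-cong (length W) (letter-tail s W)) (applyDownFrom-letter W))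

applyDownFrom-injective : ∀ {f g : ℕ → ℕ} n → applyDownFrom f n ≡ applyDownFrom g n → ∀ {i} → i < n → f i ≡ g i
applyDownFrom-injective (suc n) e {i} i<1+n with i ≟ n
... | yes refl = ∷-injectiveˡ e
... | no ne    = applyDownFrom-injective n (∷-injectiveʳ e) (≤∧≢⇒< (s≤s⁻¹ i<1+n) ne)

applyDownFrom-letter-n : ∀ {n W} → length W ≡ n → applyDownFrom (letter W) n ≡ W
applyDownFrom-letter-n {W = W} refl = applyDownFrom-letter W

letter-applyDownFrom : ∀ f n {i} → i < n → letter (applyDownFrom f n) i ≡ f i
letter-applyDownFrom f n = applyDownFrom-injective n (applyDownFrom-letter-n (length-applyDownFrom f n))

Encodes-cong : ∀ {n w T p p' q q'} → (∀ {i} → i < n → p' i ≡ p i) → (∀ {i} → i < n → q' i ≡ q i) →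
  Encodes n w T p q → Encodes n w T p' q'
Encodes-cong {w = w} {T'} hp hq e = record
  { small = λ {c} {i} c<w i<n → trans (cong (λ z → count (suc i) (column c T') + δ z (w ∸ c)) (hp i<n)) (Encodes.small e c<w i<n)
  ; large = λ {c} c<w j<n → trans (Encodes.large e c<w j<n) (cong (λ z → δ z (w ∸ c)) (sym (hq j<n)))
  }

letter-range : ∀ {n w W} → length W ≡ n → Lattice W → All (0 <_) W → count 1 W ≤ w →
  ∀ {i} → i < n → InRange w (letter (transpose W) i)
letter-range {w = w} {W} e l h le = All-applyDownFrom⁻
  (subst (All (InRange w)) (sym (applyDownFrom-letter-n (trans (transpose-length W) e)))
    (All.zip (transpose-pos W , transpose-letters≤ l h le)))

-- The transposed words encode the tableau, so that the bound `w` on column labels becomes the bound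
-- `short` on the first row of `P`.
record Corresponds (n w : ℕ) (T : List (List ℕ)) (σ : List ℕ) : Set where
  constructor corresponds
  field
    {P Q}   : List ℕ
    rs      : RS n σ P Q
    words   : Words n P Q
    short   : count 1 P ≤ w
    encodes : Encodes n w T (letter (transpose P)) (letter (transpose Q))

  open Words words public

  shortQ : count 1 Q ≤ w
  shortQ = subst (_≤ w) (shape 0) short

Corresponds-injectiveˡ : ∀ {n w T T' σ} → Tableau n w T → Tableau n w T' → Corresponds n w T σ → Corresponds n w T' σ → T ≡ T'
Corresponds-injectiveˡ t t' (corresponds rs _ _ e) (corresponds rs' _ _ e') with refl , refl ← RS-functional rs rs' =
  Encodes-injective t t' e e'

transpose-injective : ∀ {n V W} → length V ≡ n → length W ≡ n → Lattice V → Lattice W → All (0 <_) V → All (0 <_) W →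
  (∀ {i} → i < n → letter (transpose V) i ≡ letter (transpose W) i) → V ≡ W
transpose-injective {n} {V} {W} eV eW lV lW hV hW h = begin
  V                                                  ≡⟨ transpose-involutive lV hV ⟨
  transpose (transpose V)                            ≡⟨ cong transpose (applyDownFrom-letter-n (trans (transpose-length V) eV)) ⟨
  transpose (applyDownFrom (letter (transpose V)) n) ≡⟨ cong transpose (applyDownFrom-cong n h) ⟩
  transpose (applyDownFrom (letter (transpose W)) n) ≡⟨ cong transpose (applyDownFrom-letter-n (trans (transpose-length W) eW)) ⟩
  transpose (transpose W)                            ≡⟨ transpose-involutive lW hW ⟩
  W                                                  ∎
  where open ≡-Reasoning

Corresponds-injectiveʳ : ∀ {n w T σ σ'} → Corresponds n w T σ → Corresponds n w T σ' → σ ≡ σ'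
Corresponds-injectiveʳ {n} {σ' = σ'} x y = RS-injective x.rs (subst₂ (RS n σ') (sym P≡) (sym Q≡) y.rs)
  where
  module x = Corresponds x
  module y = Corresponds y
  letters = Encodes-functional x.encodes y.encodes
    (letter-range x.lengthP x.latticeP x.posP x.short) (letter-range x.lengthQ x.latticeQ x.posQ x.shortQ)
  P≡ = transpose-injective x.lengthP y.lengthP x.latticeP y.latticeP x.posP y.posP (proj₁ letters)
  Q≡ = transpose-injective x.lengthQ y.lengthQ x.latticeQ y.latticeQ x.posQ y.posQ (proj₂ letters)

Tableau⇒Bounded : ∀ {n w T} → 1 ≤ w → Tableau n w T → ∃ λ σ → Bounded n w σ × Corresponds n w T σ
Tableau⇒Bounded {n} {w} {T'} 1≤w t
  with σ , rs ← Words⇒RS (transpose-Words (Encode.words 1≤w t)) = σ , isBounded , corresponds rs words short encodes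
  where
  module t = Encode 1≤w t
  words = transpose-Words t.words
  open Words t.words
  short : count 1 (transpose t.P) ≤ w
  short = transpose-letters≤⁻ latticeP posP (applyDownFrom-All (proj₂ ∘ t.p-range))
  letters : ∀ f {i} → Lattice (applyDownFrom f n) → All (0 <_) (applyDownFrom f n) →
    i < n → letter (transpose (transpose (applyDownFrom f n))) i ≡ f i
  letters f {i} l h i<n = trans (cong (λ W → letter W i) (transpose-involutive l h)) (letter-applyDownFrom f n i<n)
  encodes : Encodes n w T' (letter (transpose (transpose t.P))) (letter (transpose (transpose t.Q)))
  -- Transposing twice gives back the words read from the tableau.
  encodes = Encodes-cong (letters t.p latticeP posP) (letters t.q latticeQ posQ) t.encodes
  isBounded : Bounded n w σ
  isBounded = record
    { size     = trans (sym (RS-lengthQ rs)) (Words.lengthQ words)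
    ; entries  = RS-range rs
    ; noRepeat = RS-distinct rs
    ; short    = subst (_≤ w) (sym (trans (lis≡best (All.map proj₁ (RS-range rs))) (RS-best rs 0))) short
    }

Bounded⇒Tableau : ∀ {n w σ} → 1 ≤ w → Bounded n w σ → ∃ λ T → Tableau n w T × Corresponds n w T σ
Bounded⇒Tableau {n} {w} {σ} 1≤w b with P , Q , rs ← RS-total (Bounded.entries b) (Bounded.noRepeat b) =
  tableau , isTableau 1≤w , corresponds rs words short encodes
  where
  words = RS⇒Words rs (Bounded.size b)
  open Words words
  short : count 1 P ≤ w
  short = subst (_≤ w) (trans (lis≡best (All.map proj₁ (Bounded.entries b))) (RS-best rs 0)) (Bounded.short b)
  P-eq : applyDownFrom (letter (transpose P)) n ≡ transpose P
  P-eq = applyDownFrom-letter-n (trans (transpose-length P) lengthP)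
  Q-eq : applyDownFrom (letter (transpose Q)) n ≡ transpose Q
  Q-eq = applyDownFrom-letter-n (trans (transpose-length Q) lengthQ)
  open Decode (subst₂ (Words n) (sym P-eq) (sym Q-eq) (transpose-Words words))
    (subst (All (_≤ w)) (sym P-eq) (transpose-letters≤ latticeP posP short))
    (subst (All (_≤ w)) (sym Q-eq) (transpose-letters≤ latticeQ posQ (subst (_≤ w) (shape 0) short)))
    using (tableau; isTableau; encodes)

theorem2p1 : (n w : ℕ) → 1 ≤ n → 1 ≤ w →
    Kostka (replicate n w) (replicate n (w ∸ 1) ++ replicate n 1) ≡ u n w
theorem2p1 n w _ 1≤w = ≤-antisym
  (length-≤ (Corresponds n w) {tableaux n w} {bounded n w}
    (Unique.filter⁺ (T? ∘ λ T → isSSYT T ∧ hasContent (content n w) T) (Unique-fillings (length (content n w)) (replicate n w)))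
    (λ T∈ → let σ , b , r = Tableau⇒Bounded 1≤w (tableaux⁻ T∈) in σ , bounded⁺ b , r)
    (λ T∈ T'∈ → Corresponds-injectiveˡ (tableaux⁻ T∈) (tableaux⁻ T'∈)))
  (length-≤ (λ σ T → Corresponds n w T σ) {bounded n w} {tableaux n w}
    (Unique.filter⁺ (T? ∘ λ σ → lis σ ≤ᵇ w) (Unique.filter⁺ (T? ∘ distinct) (Unique-allLists n n)))
    (λ σ∈ → let T , t , r = Bounded⇒Tableau 1≤w (bounded⁻ σ∈) in T , tableaux⁺ t , r)
    (λ _ _ → Corresponds-injectiveʳ))
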